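{- Let $n \geq 2$ be a positive integer. There exists a $\chi_{ig}^{AB}$-mixed-game-vertex-critical graph $G$ such that $$\left\{\chi_{ig}^{AB}(G)-\chi_{ig}^{AB}(G-x) \, | \, x \in V(G)\right\}=\{1,-2n+3,-2n+1\}.$$
   Context: All graphs are simple, undirected and finite. The AB-independence coloring game on a graph $G$ is played by Alice and Bob in rounds, round $i$ being played with color $i$ ($i=1,2,\ldots$). Within a round the players alternate moves, each move consisting of coloring a previously uncolored vertex with the color of the round so that the vertices colored in the same round form an independent set. A round is completed when no uncolored vertex can be given the color of the round (every uncolored vertex is adjacent to a vertex colored in this round). The game is over when all vertices are colored. Alice starts the first round and each further round is started by the player who did not make the last move of the previous round. Alice wants to finish in as few rounds as possible, Bob in as many rounds as possible. The number of rounds when both players play optimally is the AB-independence game chromatic number $\chi_{ig}^{AB}(G)$. For $x\in V(G)$, $G-x$ is the graph obtained from $G$ by deleting $x$ and all edges incident with $x$. A graph $G$ is $\chi_{ig}^{AB}$-mixed-game-vertex-critical if $\chi_{ig}^{AB}(G-x)\neq\chi_{ig}^{AB}(G)$ for every $x\in V(G)$, and there exist $y,y'\in V(G)$ with $\chi_{ig}^{AB}(G-y)<\chi_{ig}^{AB}(G)$ and $\chi_{ig}^{AB}(G-y')>\chi_{ig}^{AB}(G)$. -}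

module Defs where

open import Data.Bool.Base using (if_then_else_)
open import Data.Fin.Base using (Fin; punchIn)
open import Data.Fin.Properties using (all?)
open import Data.Integer.Base as ℤ using (ℤ; +_)
open import Data.List.Base using (List; []; _∷_; allFin; filter; map; null)
open import Data.List.Extrema.Nat using (min; max)
open import Data.Maybe.Base using (Maybe; just; nothing)
import Data.Maybe.Properties as Maybe
open import Data.Nat.Base using (ℕ; zero; suc; pred; _<_; _>_)
import Data.Nat.Properties as ℕ
open import Data.Product.Base using (_×_; ∃-syntax)
open import Data.Vec.Base using (Vec; lookup; replicate; _[_]≔_)
open import Function.Base using (_∘_; _on_)
open import Level using (0ℓ)
open import Relation.Binary.Core using (Rel)
open import Relation.Binary.Definitions using (Decidable; Irreflexive; Symmetric)
open import Relation.Binary.PropositionalEquality using (_≡_; _≢_; cong)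
open import Relation.Nullary.Decidable using (Dec; ¬?; _×-dec_; _→-dec_)
open import Relation.Unary using (Pred)

record Graph (m : ℕ) : Set₁ where
  field
    Adj    : Rel (Fin m) 0ℓ
    adj?   : Decidable Adj
    sym    : Symmetric Adj
    irrefl : Irreflexive _≡_ Adj

infixl 6 _−_

_−_ : ∀ {m} → Graph m → Fin m → Graph (pred m)
_−_ {suc m} G x = record
  { Adj    = Adj on punchIn x
  ; adj?   = λ i j → adj? (punchIn x i) (punchIn x j)
  ; sym    = sym
  ; irrefl = irrefl ∘ cong (punchIn x)
  }
  where open Graph G

data Player : Set where
  alice bob : Player

opponent : Player → Player
opponent alice = bob
opponent bob   = alice

-- Alice minimises and Bob maximises. The list of options is nonempty in
-- every position reached in the game, so the value at [] is irrelevant.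
optimum : Player → List ℕ → ℕ
optimum _     []       = 0
optimum alice (k ∷ ks) = min k ks
optimum bob   (k ∷ ks) = max k ks

module Game {m : ℕ} (G : Graph m) where
  open Graph G

  Colouring : Set
  Colouring = Vec (Maybe ℕ) m

  Legal : ℕ → Colouring → Pred (Fin m) 0ℓ
  Legal r c v = lookup c v ≡ nothing × (∀ u → Adj u v → lookup c u ≢ just r)

  legal? : ∀ r c v → Dec (Legal r c v)
  legal? r c v = (lookup c v ≟ nothing)
    ×-dec all? (λ u → adj? u v →-dec ¬? (lookup c u ≟ just r))
    where _≟_ = Maybe.≡-dec ℕ._≟_

  legalMoves : ℕ → Colouring → List (Fin m)
  legalMoves r c = filter (legal? r c) (allFin m)

  -- Backward induction. Every move colours exactly one vertex, so the game
  -- lasts exactly m moves; t is the number of uncoloured vertices, p the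
  -- player to move, r the current round and c the partial colouring.
  -- The values count the rounds yet to be started under optimal play.
  -- When a round is completed the player to move does not change: it is
  -- already the one who did not make the last move.
  mutual

    startRound : (t : ℕ) (p : Player) (r : ℕ) (c : Colouring) → ℕ
    startRound zero    p r c = 0
    startRound (suc t) p r c = suc (makeMove t p r c)

    duringRound : (t : ℕ) (p : Player) (r : ℕ) (c : Colouring) → ℕ
    duringRound zero    p r c = 0
    duringRound (suc t) p r c =
      if null (legalMoves r c)
      then startRound (suc t) p (suc r) c
      else makeMove t p r c

    -- Here t is the number of uncoloured vertices left after the move.
    makeMove : (t : ℕ) (p : Player) (r : ℕ) (c : Colouring) → ℕ
    makeMove t p r c = optimum p
      (map (λ v → duringRound t (opponent p) r (c [ v ]≔ just r))
           (legalMoves r c))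

χᴬᴮ : ∀ {m} → Graph m → ℕ
χᴬᴮ {m} G = Game.startRound G m alice 1 (replicate m nothing)

MixedGameVertexCritical : ∀ {m} → Graph m → Set
MixedGameVertexCritical G =
    (∀ x → χᴬᴮ (G − x) ≢ χᴬᴮ G)
  × (∃[ y ] χᴬᴮ (G − y) < χᴬᴮ G)
  × (∃[ y′ ] χᴬᴮ (G − y′) > χᴬᴮ G)

Differences : ∀ {m} → Graph m → Pred ℤ 0ℓ
Differences G d = ∃[ x ] d ≡ (+ χᴬᴮ G) ℤ.- (+ χᴬᴮ (G − x))

{-# OPTIONS --safe #-}

-- Let k = 2n. The graph is the join of Y, which is K_{k,k} minus a perfect matching, and X, which is
-- K_{4,4} minus a perfect matching with one vertex duplicated. Every round takes place inside X or
-- inside Y. If Bob opens a round in such a part, Alice answers on the same side and the part costs two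
-- rounds; if Alice opens it, Bob answers with the matched vertex and the part costs one round per pair.
-- Moves alternate across rounds, so parity decides who opens. The whole graph has odd order: Alice spends
-- one round on the triple of the twins and their partner, after which Bob has to open both parts, and
-- 1 + 2 + 2 = 5. Deleting a vertex of Y lets Alice open Y with its partner, locking a side, and Bob
-- has to open X: 4 rounds. Deleting a vertex of X lets Bob answer all of Alice's moves in Y: k rounds
-- there, and in X two if the deleted vertex leaves its partner alone, but four if it was a twin.
module Submission where

open import Defs
open import Data.Bool.Base using (Bool; true; false; not; if_then_else_)
import Data.Bool.Properties as Bool
open import Data.Empty using (⊥-elim)
open import Data.Fin.Base using (Fin; zero; suc; punchIn; punchOut)
open import Data.Fin.Properties as Fin using (punchInᵢ≢i; punchIn-injective; punchIn-punchOut)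
open import Data.Fin.Subset as Subset hiding (_∪_)
open import Data.Fin.Subset.Properties
import Data.Integer.Base as ℤ
open import Data.Integer.Base using (+_; -_; _+_; _*_)
import Data.Integer.Properties as ℤ
open import Data.Integer.Tactic.RingSolver using (solve-∀)
open import Data.List.Base using (List; []; _∷_; map; null; allFin)
import Data.List.Extrema.Nat as Extrema
open import Data.List.Membership.Propositional using () renaming (_∈_ to _∈ˡ_)
open import Data.List.Membership.Propositional.Properties using (∈-filter⁺; ∈-filter⁻; ∈-allFin; ∈-map⁺)
open import Data.List.Relation.Unary.All as All using (All; _∷_)
import Data.List.Relation.Unary.All.Properties as All
open import Data.List.Relation.Unary.Any as Any using (here; there)
open import Data.Maybe.Base using (just; nothing)
open import Data.Maybe.Properties using (just-injective)
open import Data.Nat.Base as ℕ using (ℕ; zero; suc; _≥_; _≤_; z≤n; s≤s; _<ᵇ_)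
import Data.Nat.Properties as ℕ
open import Data.Product.Base using (_×_; _,_; proj₁; proj₂; ∃-syntax; Σ-syntax)
open import Data.Product.Properties using (≡-dec)
open import Data.Sum.Base using (_⊎_; inj₁; inj₂; [_,_]′)
open import Data.Vec.Base as Vec using ([]; _∷_; lookup; tabulate; replicate; _[_]≔_)
open import Data.Vec.Properties using (lookup∘update; lookup∘update′; lookup∘tabulate; []=⇒lookup; lookup⇒[]=; lookup-replicate)
open import Function.Base using (_∘_; id)
open import Level using (0ℓ)
open import Relation.Binary.PropositionalEquality
open import Relation.Nullary using (¬_; Dec; yes; no; contradiction)
open import Relation.Nullary.Decidable using (does; ¬?; _×-dec_; _⊎-dec_; dec-true; dec-false; decidable-stable)
open import Relation.Unary using (Pred; Decidable; _≐_; _∪_; ｛_｝)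

-- The target differences dictate the sizes. With value 5 for the whole graph the deletions must
-- give 4, 2 + k and 4 + k, hence k = 2n. The gap of 2 between the last two values is why X has four
-- pairs: perfectly paired it costs four rounds, cut down to single sides it costs two. The bound n
-- ≥ 2 keeps 2 + k away from 5. The twin is there for parity: without it every vertex has a partner
-- and Bob can answer each opening. The obstacle is the size of the game tree. Upper and lower
-- bounds are therefore proved separately, each from a strategy of one player against all moves of
-- the other, and blocks are described only by what a strategy needs: lockable, independent, or made
-- of full pairs. Parity has to be tracked per block, because what matters is who must open a block
-- once the other one is used up. For Bob, a round colours at most one vertex of any clique, so the
-- constant bounds 4 and 5 only need a clique of order four, an edge from each block; the bounds
-- growing with k combine this count with the replies inside pairs.

private variable
  m : ℕ

-- Finite subsets and their cardinalities

⟪_⟫ : {P : Pred (Fin m) 0ℓ} → Decidable P → Subset m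
⟪ P? ⟫ = tabulate (does ∘ P?)

module _ {P : Pred (Fin m) 0ℓ} (P? : Decidable P) where

  ∈-⟪⟫⁺ : ∀ {v} → P v → v ∈ ⟪ P? ⟫
  ∈-⟪⟫⁺ {v} Pv = lookup⇒[]= v _ (trans (lookup∘tabulate (does ∘ P?) v) (dec-true (P? v) Pv))

  ∈-⟪⟫⁻ : ∀ {v} → v ∈ ⟪ P? ⟫ → P v
  ∈-⟪⟫⁻ {v} v∈ with P? v | trans (sym (lookup∘tabulate (does ∘ P?) v)) ([]=⇒lookup v∈)
  ... | yes Pv | _ = Pv
  ... | no  _  | ()

∉-─ : ∀ {p q : Subset m} {x} → x ∈ p ─ q → x ∉ q
∉-─ {p = _ ∷ p} {q = inside ∷ q}  {zero} () Vec.here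
∉-─ {p = _ ∷ p} {q = _ ∷ q} {suc x} (Vec.there x∈) (Vec.there x∈q) = ∉-─ x∈ x∈q

∈-─⁻ : ∀ {p q : Subset m} {x} → x ∈ p ─ q → x ∈ p
∈-─⁻ {p = p} {q} = p─q⊆p p q

∈-delete⁻ : ∀ {p : Subset m} {x y} → x ∈ p - y → x ∈ p × x ≢ y
∈-delete⁻ {y = y} x∈ = ∈-─⁻ x∈ , λ { refl → ∉-─ x∈ (x∈⁅x⁆ y) }

∣p-x∣ : ∀ {p : Subset m} {x} → x ∈ p → ∣ p ∣ ≡ suc ∣ p - x ∣
∣p-x∣ {p = _ ∷ p} Vec.here = cong (suc ∘ ∣_∣) (sym (p─⊥≡p p))
∣p-x∣ {p = inside  ∷ p} (Vec.there x∈) = cong suc (∣p-x∣ x∈)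
∣p-x∣ {p = outside ∷ p} (Vec.there x∈) = ∣p-x∣ x∈

∣p-x-y∣ : ∀ {p : Subset m} {x y} → x ∈ p → y ∈ p → y ≢ x → ∣ p ∣ ≡ 2 ℕ.+ ∣ p - x - y ∣
∣p-x-y∣ x∈ y∈ y≢x = trans (∣p-x∣ x∈) (cong suc (∣p-x∣ (x∈p∧x≢y⇒x∈p-y y∈ y≢x)))

delete-∩ : ∀ (p q : Subset m) x → (p - x) ∩ q ≡ (p ∩ q) - x
delete-∩ p q x = ⊆-antisym
  (λ u∈ → let u∈p-x , u∈q = x∈p∩q⁻ (p - x) q u∈ ; u∈p , u≢x = ∈-delete⁻ u∈p-x in
    x∈p∧x≢y⇒x∈p-y (x∈p∩q⁺ (u∈p , u∈q)) u≢x)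
  (λ u∈ → let u∈∩ , u≢x = ∈-delete⁻ u∈ ; u∈p , u∈q = x∈p∩q⁻ p q u∈∩ in
    x∈p∩q⁺ (x∈p∧x≢y⇒x∈p-y u∈p u≢x , u∈q))

∣p∩q∣+∣p─q∣ : ∀ (p q : Subset m) → ∣ p ∣ ≡ ∣ p ∩ q ∣ ℕ.+ ∣ p ─ q ∣
∣p∩q∣+∣p─q∣ [] [] = refl
∣p∩q∣+∣p─q∣ (inside  ∷ p) (inside  ∷ q) = cong suc (∣p∩q∣+∣p─q∣ p q)
∣p∩q∣+∣p─q∣ (inside  ∷ p) (outside ∷ q) = trans (cong suc (∣p∩q∣+∣p─q∣ p q)) (sym (ℕ.+-suc _ _))
∣p∩q∣+∣p─q∣ (outside ∷ p) (inside  ∷ q) = ∣p∩q∣+∣p─q∣ p q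
∣p∩q∣+∣p─q∣ (outside ∷ p) (outside ∷ q) = ∣p∩q∣+∣p─q∣ p q

≢-≢⇒≡ : ∀ {x y z : Bool} → x ≢ z → y ≢ z → x ≡ y
≢-≢⇒≡ x≢ y≢ = trans (Bool.¬-not x≢) (sym (Bool.¬-not y≢))

-- Of three consecutive indices at most one is the forbidden `i`; the two survivors carry the ends
-- of an edge in `block-clique`.
two-others : ∀ a i → ∃[ c ] ∃[ d ] (c ≤ 2 × d ≤ 2 × c ≢ d × c ℕ.+ a ≢ i × d ℕ.+ a ≢ i)
two-others a i with i ℕ.≟ a | i ℕ.≟ suc a
... | yes refl | _ = 1 , 2 , s≤s z≤n , s≤s (s≤s z≤n) , (λ ()) , ℕ.1+n≢n , ℕ.>⇒≢ (ℕ.m<n+m a {2} (s≤s z≤n))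
... | no a≢ | yes refl = 0 , 2 , z≤n , s≤s (s≤s z≤n) , (λ ()) , a≢ ∘ sym , ℕ.1+n≢n
... | no a≢ | no 1+a≢ = 0 , 1 , z≤n , s≤s z≤n , (λ ()) , a≢ ∘ sym , 1+a≢ ∘ sym

-- One-sided bounds and the parity of turns

opponent-involutive : ∀ p → opponent (opponent p) ≡ p
opponent-involutive alice = refl
opponent-involutive bob   = refl

-- b is what the player can guarantee: an upper bound for Alice, a lower bound for Bob.
Bound : Player → ℕ → ℕ → Set
Bound alice b k = k ≤ b
Bound bob   b k = b ≤ k

Bound-suc : ∀ p {b k} → Bound p b k → Bound p (suc b) (suc k)
Bound-suc alice = s≤s
Bound-suc bob   = s≤s

optimum-own : ∀ p {ks k b} → k ∈ˡ ks → Bound p b k → Bound p b (optimum p ks)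
optimum-own alice {k ∷ ks} (here refl) k≤b = Extrema.min≤v⁺ k ks (inj₁ k≤b)
optimum-own alice {k ∷ ks} (there k∈)  k≤b =
  Extrema.min≤v⁺ k ks (inj₂ (Any.map (λ { refl → k≤b }) k∈))
optimum-own bob   {k ∷ ks} (here refl) b≤k = Extrema.v≤max⁺ k ks (inj₁ b≤k)
optimum-own bob   {k ∷ ks} (there k∈)  b≤k =
  Extrema.v≤max⁺ k ks (inj₂ (Any.map (λ { refl → b≤k }) k∈))

optimum-all : ∀ p o {k ks b} → All (Bound p b) (k ∷ ks) → Bound p b (optimum o (k ∷ ks))
optimum-all alice alice {k} {ks} (h ∷ hs) = Extrema.min≤v⁺ k ks (inj₁ h)
optimum-all alice bob   (h ∷ hs) = Extrema.max≤v⁺ h hs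
optimum-all bob   alice (h ∷ hs) = Extrema.v≤min⁺ h hs
optimum-all bob   bob   {k} {ks} (h ∷ hs) = Extrema.v≤max⁺ k ks (inj₁ h)

-- Moves strictly alternate, also across rounds, so the player to move is determined by the
-- parity of the number of uncoloured vertices; q is the player who would move after the last vertex.
turn : Player → ℕ → Player
turn q zero    = q
turn q (suc t) = opponent (turn q t)

turn-even : ∀ q h → turn q (h ℕ.* 2) ≡ q
turn-even q zero    = refl
turn-even q (suc h) = trans (opponent-involutive _) (turn-even q h)

turn-delete : ∀ q {p} {W : Subset m} {v} → v ∈ W → turn q ∣ W ∣ ≡ p → turn q ∣ W - v ∣ ≡ opponent p
turn-delete q v∈ e = trans (sym (opponent-involutive _)) (cong opponent (trans (cong (turn q) (sym (∣p-x∣ v∈))) e))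

-- Strategies on positions without colours

module Play (G : Graph m) (q : Player) where
  open Graph G using (Adj; adj?)
  open Game G

  stays? : ∀ L v → Decidable λ u → u ∈ L × u ≢ v × ¬ Adj v u
  stays? L v u = (u ∈? L) ×-dec ¬? (u Fin.≟ v) ×-dec ¬? (adj? v u)

  after : Subset m → Fin m → Subset m
  after L v = ⟪ stays? L v ⟫

  ∈-after⁺ : ∀ {L v u} → u ∈ L → u ≢ v → ¬ Adj v u → u ∈ after L v
  ∈-after⁺ {L} {v} u∈ u≢v ¬a = ∈-⟪⟫⁺ (stays? L v) (u∈ , u≢v , ¬a)

  ∈-after⁻ : ∀ {L v u} → u ∈ after L v → u ∈ L × u ≢ v × ¬ Adj v u
  ∈-after⁻ {L} {v} = ∈-⟪⟫⁻ (stays? L v)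

  -- W is the set of uncoloured vertices and L the set of legal moves, so that colours can be forgotten.
  record Start (W : Subset m) (t r : ℕ) (c : Colouring) : Set where
    field
      size    : ∣ W ∣ ≡ t
      free⁺   : ∀ {v} → v ∈ W → lookup c v ≡ nothing
      free⁻   : ∀ {v} → lookup c v ≡ nothing → v ∈ W
      bounded : ∀ {v k} → lookup c v ≡ just k → k ≤ r

  record Position (W L : Subset m) (t r : ℕ) (c : Colouring) : Set where
    field
      start  : Start W t r c
      legal⁺ : ∀ {v} → v ∈ L → Legal r c v
      legal⁻ : ∀ {v} → Legal r c v → v ∈ L
    open Start start public

  Guarantee : Player → ℕ → (W L : Subset m) → Set
  Guarantee p b W L = ∀ {t r c} → Position W L t r c → Bound p b (duringRound t (turn q t) r c)

  Guarantee₀ : Player → ℕ → (W : Subset m) → Set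
  Guarantee₀ p b W = ∀ {t r c} → Start W t r c → Bound p b (startRound t (turn q t) (suc r) c)

  -- All colours used so far are at most `r`, so the new colour `suc r` conflicts with nothing and
  -- every uncoloured vertex is legal.
  fresh : ∀ {W t r c} → Start W t r c → Position W W t (suc r) c
  fresh {c = c} S = record
    { start  = record { size = size ; free⁺ = free⁺ ; free⁻ = free⁻
                      ; bounded = λ e → ℕ.m≤n⇒m≤1+n (bounded e) }
    ; legal⁺ = λ v∈ → free⁺ v∈ , λ u _ e → ℕ.<-irrefl refl (bounded e)
    ; legal⁻ = free⁻ ∘ proj₁
    }
    where open Start S

  move : ∀ {W L t r c v} → Position W L (suc t) r c → v ∈ L →
         Position (W - v) (after L v) t r (c [ v ]≔ just r)
  move {W} {L} {t} {r} {c} {v} P v∈L = record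
    { start  = record
      { size    = ℕ.suc-injective (trans (sym (∣p-x∣ (free⁻ (proj₁ (legal⁺ v∈L))))) size)
      ; free⁺   = λ u∈ → let u∈W , u≢v = ∈-delete⁻ u∈ in trans (lookup∘update′ u≢v c _) (free⁺ u∈W)
      ; free⁻   = λ {u} e → let u≢v = free-≢ u e in
                  x∈p∧x≢y⇒x∈p-y (free⁻ (trans (sym (lookup∘update′ u≢v c _)) e)) u≢v
      ; bounded = λ {u} → bounded′ u
      }
    ; legal⁺ = λ {u} u∈ → let u∈L , u≢v , ¬a = ∈-after⁻ u∈ in
        trans (lookup∘update′ u≢v c _) (proj₁ (legal⁺ u∈L)) , λ w a → no-conflict w u a (u∈L) ¬a
    ; legal⁻ = λ {u} l → let e , nc = l ; u≢v = free-≢ u e in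
        ∈-after⁺ (legal⁻ (trans (sym (lookup∘update′ u≢v c _)) e , λ w a e′ → nc w a
            (trans (lookup∘update′ (λ { refl → contradiction (trans (sym (proj₁ (legal⁺ v∈L))) e′) λ () }) c _) e′)))
          u≢v (λ a → nc v a (lookup∘update v c _))
    }
    where
    open Position P
    free-≢ : ∀ u → lookup (c [ v ]≔ just r) u ≡ nothing → u ≢ v
    free-≢ u e refl = contradiction (trans (sym (lookup∘update v c _)) e) λ ()
    bounded′ : ∀ u {k} → lookup (c [ v ]≔ just r) u ≡ just k → k ≤ r
    bounded′ u e with u Fin.≟ v
    ... | yes refl = ℕ.≤-reflexive (sym (just-injective (trans (sym (lookup∘update v c _)) e)))
    ... | no u≢v = bounded (trans (sym (lookup∘update′ u≢v c _)) e)
    no-conflict : ∀ w u → Adj w u → u ∈ L → ¬ Adj v u → lookup (c [ v ]≔ just r) w ≢ just r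
    no-conflict w u a u∈ ¬a e with w Fin.≟ v
    ... | yes refl = ¬a a
    ... | no w≢v = proj₂ (legal⁺ u∈) w a (trans (sym (lookup∘update′ w≢v c _)) e)

  private
    listed : ∀ {W L t r c} → Position W L t r c → ∀ {v} → v ∈ L → v ∈ˡ legalMoves r c
    listed {r = r} {c} P {v} v∈L = ∈-filter⁺ (legal? r c) (∈-allFin v) (Position.legal⁺ P v∈L)

    unlisted : ∀ {W L t r c} → Position W L t r c → ∀ {v} → v ∈ˡ legalMoves r c → v ∈ L
    unlisted {r = r} {c} P v∈ = Position.legal⁻ P (proj₂ (∈-filter⁻ (legal? r c) {xs = allFin m} v∈))

    null-∈ : ∀ {A : Set} {xs : List A} {x} → x ∈ˡ xs → null xs ≡ false
    null-∈ (here _)  = refl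
    null-∈ (there _) = refl

    null-∉ : ∀ {A : Set} {xs : List A} → (∀ {x} → ¬ x ∈ˡ xs) → null xs ≡ true
    null-∉ {xs = []}    _ = refl
    null-∉ {xs = x ∷ _} ∉ = ⊥-elim (∉ (here refl))

  duringRound-move : ∀ {W L t r c} p → Position W L (suc t) r c → Nonempty L →
                     duringRound (suc t) p r c ≡ makeMove t p r c
  duringRound-move {t = t} {r} {c} p P (v , v∈L) =
    cong (if_then startRound (suc t) p (suc r) c else makeMove t p r c) (null-∈ (listed P v∈L))

  duringRound-over : ∀ {W L t r c} p → Position W L t r c → Empty L →
                     duringRound t p r c ≡ startRound t p (suc r) c
  duringRound-over {t = zero}  p P _ = refl
  duringRound-over {t = suc t} {r} {c} p P L≡∅ =
    cong (if_then startRound (suc t) p (suc r) c else makeMove t p r c) (null-∉ λ x∈ → L≡∅ (_ , unlisted P x∈))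

  private
    option : ∀ {t r c v} p {b} → Bound p b (duringRound t (turn q t) r (c [ v ]≔ just r)) →
             Bound p b (duringRound t (opponent (turn q (suc t))) r (c [ v ]≔ just r))
    option {t} {r} p = subst (λ o → Bound p _ (duringRound t o r _)) (sym (opponent-involutive (turn q t)))

  own-move : ∀ p {W L b v} → turn q ∣ W ∣ ≡ p → v ∈ L →
             Guarantee p b (W - v) (after L v) → Guarantee p b W L
  own-move p {W} {L} {b} {v} t≡p v∈L g {t} {r} {c} P = go t refl
    where
    v∈W = Position.free⁻ P (proj₁ (Position.legal⁺ P v∈L))
    go : ∀ t′ → t ≡ t′ → Bound p b (duringRound t (turn q t) r c)
    go zero refl = contradiction (trans (sym (∣p-x∣ v∈W)) (Position.size P)) λ ()
    go (suc t) refl = subst (Bound p b) (sym (duringRound-move _ P (v , v∈L)))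
      (subst (λ o → Bound p b (optimum o (map _ (legalMoves r c))))
        (trans (sym t≡p) (cong (turn q) (Position.size P)))
        (optimum-own p (∈-map⁺ _ (listed P v∈L)) (option {t} p {b} (g (move P v∈L)))))

  -- A bound shared by all options survives both `min` and `max`, so the player on move need not be
  -- known. A legal move must exist, since otherwise the round ends here.
  any-move : ∀ p {W L b} → Nonempty L →
             (∀ {v} → v ∈ L → Guarantee p b (W - v) (after L v)) → Guarantee p b W L
  any-move p {W} {L} {b} (v , v∈L) g {t} {r} {c} P = go t refl
    where
    v∈W = Position.free⁻ P (proj₁ (Position.legal⁺ P v∈L))
    all : ∀ t xs → v ∈ˡ xs → (∀ {x} → x ∈ˡ xs → x ∈ˡ legalMoves r c) → Position W L (suc t) r c →
          Bound p b (optimum (turn q (suc t)) (map (λ v → duringRound t (opponent (turn q (suc t))) r (c [ v ]≔ just r)) xs))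
    all t (x ∷ xs) _ sub P = optimum-all p (turn q (suc t)) (All.map⁺ (All.tabulate λ x∈ →
      option {t} p {b} (g (unlisted P (sub x∈)) (move P (unlisted P (sub x∈))))))
    go : ∀ t′ → t ≡ t′ → Bound p b (duringRound t (turn q t) r c)
    go zero refl = contradiction (trans (sym (∣p-x∣ v∈W)) (Position.size P)) λ ()
    go (suc t) refl = subst (Bound p b) (sym (duringRound-move _ P (v , v∈L)))
      (all t (legalMoves r c) (listed P v∈L) id P)

  round-over : ∀ p {W L b} → Empty L → Guarantee₀ p b W → Guarantee p b W L
  round-over p L≡∅ g P = subst (Bound p _) (sym (duringRound-over _ P L≡∅)) (g (Position.start P))

  new-round : ∀ p {W b} → Nonempty W → Guarantee p b W W → Guarantee₀ p (suc b) W
  new-round p (v , v∈W) g {zero} S = contradiction (trans (sym (∣p-x∣ v∈W)) (Start.size S)) λ ()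
  new-round p W≢∅ g {suc t} S = Bound-suc p (subst (Bound p _) (duringRound-move _ (fresh S) W≢∅) (g (fresh S)))

  game-over : ∀ p {W b} → Empty W → Bound p b 0 → Guarantee₀ p b W
  game-over p W≡∅ h {zero} S = h
  game-over p {W} W≡∅ h {suc t} S = contradiction (trans (sym (Start.size S)) (trans (cong ∣_∣ (Empty-unique W≡∅)) (∣⊥∣≡0 m))) λ ()

  initial : ∀ p {b} → turn q m ≡ alice → Guarantee₀ p b ⊤ → Bound p b (χᴬᴮ G)
  initial p {b} t≡ g = subst (λ o → Bound p b (startRound m o 1 (replicate m nothing))) t≡ (g record
    { size    = ∣⊤∣≡n m
    ; free⁺   = λ {v} _ → lookup-replicate v _
    ; free⁻   = λ _ → ∈⊤
    ; bounded = λ {v} e → contradiction (trans (sym (lookup-replicate v _)) e) λ () })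

-- Labels, blocks and index ranges

-- The vertices (i , false) and (i , true) form the i-th nonadjacent pair; pairs 0 to 3 make up the
-- block X, all others the block Y, and different blocks are joined. Labels need not be distinct.
Label : Set
Label = ℕ × Bool

inX : ℕ → Bool
inX i = i <ᵇ 4

LAdj : Label → Label → Set
LAdj (i , s) (j , t) = inX i ≢ inX j ⊎ (i ≢ j × s ≢ t)

inX-low : ∀ c → c ≤ 2 → inX (c ℕ.+ 0) ≡ true
inX-low zero _ = refl
inX-low (suc zero) _ = refl
inX-low (suc (suc zero)) _ = refl
inX-low (suc (suc (suc _))) (s≤s (s≤s ()))

inX-high : ∀ c → inX (c ℕ.+ 4) ≡ false
inX-high c = cong inX (ℕ.+-comm c 4)

-- Describing `W′` by membership instead of building it avoids deciding `P`, and lets the set left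
-- by a chain of deletions be used without rewriting it.
record Restriction (W : Subset m) (P : Pred (Fin m) 0ℓ) (W′ : Subset m) : Set where
  field
    ∈-base : ∀ {u} → u ∈ W′ → u ∈ W
    ∈-pred : ∀ {u} → u ∈ W′ → P u
    ∈-both : ∀ {u} → u ∈ W → P u → u ∈ W′

open Restriction

_≟ₗ_ : (a b : Label) → Dec (a ≡ b)
_≟ₗ_ = ≡-dec ℕ._≟_ Bool._≟_

nonzeroInX? : (l : Label) → Dec (inX (proj₁ l) ≡ true × proj₁ l ≢ 0)
nonzeroInX? l = (inX (proj₁ l) Bool.≟ true) ×-dec ¬? (proj₁ l ℕ.≟ 0)

module Indices {N k : ℕ} (N≡4+k : N ≡ 4 ℕ.+ k) (3≤k : 3 ≤ k) where

  within : ∀ {i} → i ℕ.< 4 ℕ.+ k → i ℕ.< N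
  within = subst (_ ℕ.<_) (sym N≡4+k)

  0<N : 0 ℕ.< N
  0<N = within (s≤s z≤n)

  low : ∀ c a → c ≤ 2 → a ≡ 0 ⊎ a ≡ 4 → c ℕ.+ a ℕ.< N
  low c a c≤ a∈ = within (ℕ.<-≤-trans (ℕ.+-mono-≤ {suc c} {3} (s≤s c≤) (a≤4 a∈)) (ℕ.≤-trans (ℕ.≤-reflexive (ℕ.+-comm 3 4)) (ℕ.+-monoʳ-≤ 4 3≤k)))
    where
    a≤4 : ∀ {a} → a ≡ 0 ⊎ a ≡ 4 → a ≤ 4
    a≤4 (inj₁ refl) = z≤n
    a≤4 (inj₂ refl) = ℕ.≤-refl

  two-low : ∀ {a i} → a ≤ 4 → i ≡ a ⊎ i ≡ suc a → i ℕ.< N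
  two-low a≤ (inj₁ refl) = within (ℕ.≤-trans (s≤s a≤) (ℕ.+-monoʳ-≤ 4 (ℕ.≤-trans (s≤s z≤n) 3≤k)))
  two-low a≤ (inj₂ refl) = within (ℕ.≤-trans (s≤s (s≤s a≤)) (ℕ.+-monoʳ-≤ 4 (ℕ.≤-trans (s≤s (s≤s z≤n)) 3≤k)))

-- How a round ends in a labelled graph

module Labelled (G : Graph m) (q : Player) (lab : Fin m → Label)
  (adj⁺ : ∀ {u v} → LAdj (lab u) (lab v) → Graph.Adj G u v)
  (adj⁻ : ∀ {u v} → Graph.Adj G u v → LAdj (lab u) (lab v)) where

  open Graph G using (Adj)
  open Play G q

  ix : Fin m → ℕ
  ix = proj₁ ∘ lab

  sd bl : Fin m → Bool
  sd = proj₂ ∘ lab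
  bl = inX ∘ ix

  SameSide : Fin m → Fin m → Set
  SameSide v u = bl u ≡ bl v × sd u ≡ sd v

  nonadj⁺ : ∀ {u v} → bl u ≡ bl v → ix u ≡ ix v ⊎ sd u ≡ sd v → ¬ Adj u v
  nonadj⁺ b e a with adj⁻ a | e
  ... | inj₁ b≢       | _      = b≢ b
  ... | inj₂ (i≢ , _) | inj₁ i = i≢ i
  ... | inj₂ (_ , s≢) | inj₂ s = s≢ s

  nonadj⁻ : ∀ {u v} → ¬ Adj u v → bl u ≡ bl v × (ix u ≡ ix v ⊎ sd u ≡ sd v)
  nonadj⁻ {u} {v} ¬a with bl u Bool.≟ bl v | ix u ℕ.≟ ix v | sd u Bool.≟ sd v
  ... | no b≢ | _     | _     = contradiction (adj⁺ (inj₁ b≢)) ¬a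
  ... | yes b | yes i | _     = b , inj₁ i
  ... | yes b | no _  | yes s = b , inj₂ s
  ... | yes b | no i≢ | no s≢ = contradiction (adj⁺ (inj₂ (i≢ , s≢))) ¬a

  -- Among pairwise nonadjacent legal vertices a move removes only itself from the legal set. Hence
  -- all of `L` is coloured in this round, in whatever order and by whomever.
  finish : ∀ p {W L b} → (∀ {u v} → u ∈ L → v ∈ L → ¬ Adj u v) →
           Guarantee₀ p b (W ─ L) → Guarantee p b W L
  finish p {W} {L} {b} = go ∣ L ∣ refl
    where
    go : ∀ n {W L} → ∣ L ∣ ≡ n → (∀ {u v} → u ∈ L → v ∈ L → ¬ Adj u v) →
         Guarantee₀ p b (W ─ L) → Guarantee p b W L
    go n {W} {L} size indep g with nonempty? L
    ... | no L≡∅ = round-over p L≡∅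
      (subst (Guarantee₀ p b) (trans (cong (W ─_) (Empty-unique L≡∅)) (p─⊥≡p W)) g)
    go zero {W} {L} size indep g | yes (_ , v∈L) = contradiction (trans (sym (∣p-x∣ v∈L)) size) λ ()
    go (suc n) {W} {L} size indep g | yes L≢∅ = any-move p L≢∅ λ {v} v∈L →
      let after≡ : after L v ≡ L - v
          after≡ = ⊆-antisym
            (λ u∈ → let u∈L , u≢v , _ = ∈-after⁻ u∈ in x∈p∧x≢y⇒x∈p-y u∈L u≢v)
            (λ u∈ → let u∈L , u≢v = ∈-delete⁻ u∈ in ∈-after⁺ u∈L u≢v (indep v∈L u∈L))
      in subst (Guarantee p b (W - v)) (sym after≡)
        (go n (ℕ.suc-injective (trans (sym (∣p-x∣ v∈L)) size))
          (λ u∈ w∈ → indep (proj₁ (∈-delete⁻ u∈)) (proj₁ (∈-delete⁻ w∈)))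
          (subst (Guarantee₀ p b)
            (⊆-antisym
              (λ x∈ → x∈p∧x∉q⇒x∈p─q
                (x∈p∧x≢y⇒x∈p-y (∈-─⁻ x∈) λ { refl → ∉-─ x∈ v∈L })
                (∉-─ x∈ ∘ proj₁ ∘ ∈-delete⁻))
              (λ x∈ → let x∈W , x≢v = ∈-delete⁻ (∈-─⁻ x∈) in
                x∈p∧x∉q⇒x∈p─q x∈W λ x∈L → ∉-─ x∈ (x∈p∧x≢y⇒x∈p-y x∈L x≢v)))
            g))

  -- The vertex `v` opens the round, which is why `W` also serves as the legal set before the move.
  Round : Player → ℕ → Subset m → Fin m → Set
  Round p b W v = Guarantee p b (W - v) (after W v)

  Independent : Bool → Subset m → Set
  Independent β W = ∀ {u v} → u ∈ W → v ∈ W → bl u ≡ β → bl v ≡ β → ¬ Adj u v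

  -- The other block is joined to `v` and drops out at once, while nothing in the block of `v`
  -- conflicts; so the round uses up exactly this block.
  independent-round : ∀ p {b W v} → Independent (bl v) W → v ∈ W →
    (∀ {W′} → Restriction W (λ u → bl u ≢ bl v) W′ → Guarantee₀ p b W′) → Round p b W v
  independent-round p {W = W} {v} indep v∈W g = finish p
    (λ x∈ y∈ → let x∈W , _ , vx = ∈-after⁻ x∈ ; y∈W , _ , vy = ∈-after⁻ y∈ in
      indep x∈W y∈W (sym (proj₁ (nonadj⁻ vx))) (sym (proj₁ (nonadj⁻ vy))))
    (g record
      { ∈-base = proj₁ ∘ ∈-delete⁻ ∘ ∈-─⁻
      ; ∈-pred = λ x∈ e → let x∈W , x≢v = ∈-delete⁻ (∈-─⁻ x∈) in
                 ∉-─ x∈ (∈-after⁺ x∈W x≢v (indep v∈W x∈W refl e))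
      ; ∈-both = λ x∈W b≢ → x∈p∧x∉q⇒x∈p─q (x∈p∧x≢y⇒x∈p-y x∈W λ { refl → b≢ refl })
                 λ x∈ → let _ , _ , vx = ∈-after⁻ x∈ in b≢ (sym (proj₁ (nonadj⁻ vx)))
      })

  -- A vertex nonadjacent to `v` but on the other side would share its index, which the hypothesis
  -- excludes. One move therefore locks the side.
  solo-round : ∀ p {b W v} → (∀ {u} → u ∈ W → ix u ≡ ix v → sd u ≡ sd v) →
    (∀ {W′} → Restriction W (λ u → ¬ SameSide v u) W′ → Guarantee₀ p b W′) → Round p b W v
  solo-round p {W = W} {v} solo g = finish p
    (λ x∈ y∈ → nonadj⁺ (trans (proj₁ (side x∈)) (sym (proj₁ (side y∈))))
                        (inj₂ (trans (proj₂ (side x∈)) (sym (proj₂ (side y∈))))))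
    (g record
      { ∈-base = proj₁ ∘ ∈-delete⁻ ∘ ∈-─⁻
      ; ∈-pred = λ x∈ (b , s) → let x∈W , x≢v = ∈-delete⁻ (∈-─⁻ x∈) in
                 ∉-─ x∈ (∈-after⁺ x∈W x≢v (nonadj⁺ (sym b) (inj₂ (sym s))))
      ; ∈-both = λ x∈W ¬s → x∈p∧x∉q⇒x∈p─q (x∈p∧x≢y⇒x∈p-y x∈W λ { refl → ¬s (refl , refl) })
                 λ x∈ → ¬s (side x∈)
      })
    where
    side : ∀ {x} → x ∈ after W v → SameSide v x
    side x∈ with ∈-after⁻ x∈
    ... | x∈W , _ , vx with nonadj⁻ vx
    ... | b , inj₁ i = sym b , solo x∈W (sym i)
    ... | b , inj₂ s = sym b , sym s

  -- A vertex of the other side of the block is adjacent to v or to w.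
  lock-round : ∀ p {b W v w} → SameSide v w → ix w ≢ ix v →
    (∀ {W′} → Restriction W (λ u → ¬ SameSide v u) W′ → Guarantee₀ p b W′) →
    Guarantee p b (W - v - w) (after (after W v) w)
  lock-round p {W = W} {v} {w} (wb , ws) w≢ g = finish p
    (λ x∈ y∈ → nonadj⁺ (trans (proj₁ (side x∈)) (sym (proj₁ (side y∈))))
                        (inj₂ (trans (proj₂ (side x∈)) (sym (proj₂ (side y∈))))))
    (g record
      { ∈-base = proj₁ ∘ ∈-delete⁻ ∘ proj₁ ∘ ∈-delete⁻ ∘ ∈-─⁻
      ; ∈-pred = λ x∈ (b , s) → let x∈Wv , x≢w = ∈-delete⁻ (∈-─⁻ x∈) ; x∈W , x≢v = ∈-delete⁻ x∈Wv in
                 ∉-─ x∈ (∈-after⁺ (∈-after⁺ x∈W x≢v (nonadj⁺ (sym b) (inj₂ (sym s))))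
                   x≢w (nonadj⁺ (trans wb (sym b)) (inj₂ (trans ws (sym s)))))
      ; ∈-both = λ x∈W ¬s → x∈p∧x∉q⇒x∈p─q
                   (x∈p∧x≢y⇒x∈p-y (x∈p∧x≢y⇒x∈p-y x∈W λ { refl → ¬s (refl , refl) }) λ { refl → ¬s (wb , ws) })
                   λ x∈ → ¬s (side x∈)
      })
    where
    side : ∀ {x} → x ∈ after (after W v) w → SameSide v x
    side x∈ with ∈-after⁻ x∈
    ... | x∈L , _ , wx with ∈-after⁻ x∈L
    ... | _ , _ , vx with nonadj⁻ vx | nonadj⁻ wx
    ... | b , inj₂ s | _            = sym b , sym s
    ... | b , inj₁ i | _ , inj₂ s  = sym b , trans (sym s) ws
    ... | b , inj₁ i | _ , inj₁ i′ = contradiction (trans i′ (sym i)) w≢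

  -- Alice's locking strategy

  block? : ∀ β → Decidable λ v → bl v ≡ β
  block? β v = bl v Bool.≟ β

  block : Bool → Subset m
  block β = ⟪ block? β ⟫

  ∈-∩-block⁺ : ∀ {β W v} → v ∈ W → bl v ≡ β → v ∈ W ∩ block β
  ∈-∩-block⁺ v∈ b = x∈p∩q⁺ (v∈ , ∈-⟪⟫⁺ (block? _) b)

  ∈-∩-block⁻ : ∀ {β W v} → v ∈ W ∩ block β → v ∈ W × bl v ≡ β
  ∈-∩-block⁻ {β} {W} v∈ = let v∈W , v∈β = x∈p∩q⁻ W (block β) v∈ in v∈W , ∈-⟪⟫⁻ (block? β) v∈β

  Agree : Bool → Subset m → Subset m → Set
  Agree β W W′ = ∀ {u} → bl u ≡ β → (u ∈ W → u ∈ W′) × (u ∈ W′ → u ∈ W)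

  agree-∩ : ∀ {β W W′} → Agree β W W′ → W ∩ block β ≡ W′ ∩ block β
  agree-∩ ag = ⊆-antisym
    (λ x∈ → let x∈W , b = ∈-∩-block⁻ x∈ in ∈-∩-block⁺ (proj₁ (ag b) x∈W) b)
    (λ x∈ → let x∈W , b = ∈-∩-block⁻ x∈ in ∈-∩-block⁺ (proj₂ (ag b) x∈W) b)

  -- Whichever vertex of the block is played first, a second one of the same side can be added, and
  -- then the round consumes exactly that side.
  Lockable : Bool → Subset m → Set
  Lockable β W = ∀ {v} → v ∈ W → bl v ≡ β → ∃[ w ] (w ∈ W × SameSide v w × ix w ≢ ix v)

  agree-lockable : ∀ {β W W′} → Agree β W W′ → Lockable β W → Lockable β W′
  agree-lockable ag lk v∈ b = let w , w∈ , (wb , ws) , w≢ = lk (proj₂ (ag b) v∈) b in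
    w , proj₁ (ag (trans wb b)) w∈ , (wb , ws) , w≢

  independent-⊆ : ∀ {β W W′} → (∀ {u} → u ∈ W′ → u ∈ W) → Independent β W → Independent β W′
  independent-⊆ sub indep u∈ v∈ = indep (sub u∈) (sub v∈)

  alice-locks : ∀ {b W v} → turn q ∣ W ∣ ≡ bob → v ∈ W → ∃[ w ] (w ∈ W × SameSide v w × ix w ≢ ix v) →
    (∀ {W′} → Restriction W (λ u → ¬ SameSide v u) W′ → Guarantee₀ alice b W′) → Round alice b W v
  alice-locks e v∈ (w , w∈ , same , w≢) g = own-move alice (turn-delete q v∈ e)
    (∈-after⁺ w∈ (λ { refl → w≢ refl }) (nonadj⁺ (sym (proj₁ same)) (inj₂ (sym (proj₂ same)))))
    (lock-round alice same w≢ g)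

  locked-independent : ∀ {W W′ v} → Restriction W (λ u → ¬ SameSide v u) W′ → Independent (bl v) W′
  locked-independent R u∈ w∈ ub wb = nonadj⁺ (trans ub (sym wb)) (inj₂
    (trans (Bool.¬-not (λ s → ∈-pred R u∈ (ub , s))) (sym (Bool.¬-not (λ s → ∈-pred R w∈ (wb , s))))))

  locked-agree : ∀ {W W′ v β} → bl v ≢ β → Restriction W (λ u → ¬ SameSide v u) W′ → Agree β W W′
  locked-agree v≢ R b = (λ u∈ → ∈-both R u∈ λ (e , _) → v≢ (trans (sym e) b)) , ∈-base R

  other-agree : ∀ {W W′ v β} → bl v ≢ β → Restriction W (λ u → bl u ≢ bl v) W′ → Agree β W W′
  other-agree v≢ R b = (λ u∈ → ∈-both R u∈ λ e → v≢ (trans (sym e) b)) , ∈-base R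

  one-round : ∀ {W} → (∀ {u v} → u ∈ W → v ∈ W → ¬ Adj u v) → Guarantee₀ alice 1 W
  one-round {W} indep with nonempty? W
  ... | no W≡∅ = game-over alice W≡∅ z≤n
  ... | yes W≢∅ = new-round alice W≢∅ (any-move alice W≢∅ λ {v} v∈ →
    independent-round alice (λ x∈ y∈ _ _ → indep x∈ y∈) v∈ λ R →
      game-over alice (λ (u , u∈) → ∈-pred R u∈ (sym (proj₁ (nonadj⁻ (indep v∈ (∈-base R u∈)))))) z≤n)

  two-rounds : ∀ {W} → (∀ β → Independent β W) → Guarantee₀ alice 2 W
  two-rounds {W} indep with nonempty? W
  ... | no W≡∅ = game-over alice W≡∅ z≤n
  ... | yes W≢∅ = new-round alice W≢∅ (any-move alice W≢∅ λ {v} v∈ →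
    independent-round alice (indep (bl v)) v∈ λ R → one-round λ x∈ y∈ →
      indep _ (∈-base R x∈) (∈-base R y∈) refl (≢-≢⇒≡ (∈-pred R y∈) (∈-pred R x∈)))

  lockable-alone : ∀ {β W} → Lockable β W → (∀ {u} → u ∈ W → bl u ≡ β) → turn q ∣ W ∣ ≡ bob →
                   Guarantee₀ alice 2 W
  lockable-alone {β} {W} lk only e with nonempty? W
  ... | no W≡∅ = game-over alice W≡∅ z≤n
  ... | yes W≢∅ = new-round alice W≢∅ (any-move alice W≢∅ λ {v} v∈ →
    alice-locks e v∈ (lk v∈ (only v∈)) λ R → one-round λ x∈ y∈ →
      locked-independent R x∈ y∈ (trans (only (∈-base R x∈)) (sym (only v∈)))
                                 (trans (only (∈-base R y∈)) (sym (only v∈))))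

  -- The parity hypothesis puts Bob on move once only the lockable block is left. So Alice, if on
  -- move, uses up the independent block; if Bob is on move, either block he opens suits her.
  lockable-independent : ∀ {β W} → Lockable β W → Independent (not β) W →
    turn q ∣ W ∩ block β ∣ ≡ bob → Guarantee₀ alice 3 W
  lockable-independent {β} {W} lk indep e = go (nonempty? W) (turn q ∣ W ∣) refl
    where
    other : ∀ {v} → v ∈ W → bl v ≢ β → Round alice 2 W v
    other v∈ v≢ = independent-round alice (subst (λ γ → Independent γ W) (sym (Bool.¬-not v≢)) indep) v∈ λ {W′} R →
      let ag = other-agree v≢ R
          only : ∀ {u} → u ∈ W′ → bl u ≡ β
          only u∈ = ≢-≢⇒≡ (∈-pred R u∈) (v≢ ∘ sym)
      in lockable-alone (agree-lockable ag lk) only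
        (trans (cong (turn q ∘ ∣_∣) (trans
          (⊆-antisym (λ u∈ → ∈-∩-block⁺ u∈ (only u∈)) (proj₁ ∘ ∈-∩-block⁻)) (sym (agree-∩ ag)))) e)
    go : Dec (Nonempty W) → ∀ p → turn q ∣ W ∣ ≡ p → Guarantee₀ alice 3 W
    go (no W≡∅) _ _ = game-over alice W≡∅ z≤n
    go (yes W≢∅) bob e′ = new-round alice W≢∅ (any-move alice W≢∅ λ {v} v∈ → reply v∈ (bl v Bool.≟ β))
      where
      reply : ∀ {v} → v ∈ W → Dec (bl v ≡ β) → Round alice 2 W v
      reply v∈ (no v≢) = other v∈ v≢
      reply {v} v∈ (yes vβ) = alice-locks e′ v∈ (lk v∈ vβ) λ {W′} R → two-rounds λ γ → rest R γ (bl v Bool.≟ γ)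
        where
        rest : ∀ {W′} → Restriction W (λ u → ¬ SameSide v u) W′ → ∀ γ → Dec (bl v ≡ γ) → Independent γ W′
        rest R γ (yes refl) = locked-independent R
        rest R γ (no v≢γ) = independent-⊆ (∈-base R)
          (subst (λ γ → Independent γ W) (trans (cong not (sym vβ)) (sym (Bool.¬-not (v≢γ ∘ sym)))) indep)
    go (yes W≢∅) alice e′ with nonempty? (W ∩ block (not β))
    ... | yes (v , v∈) = let v∈W , vb = ∈-∩-block⁻ v∈ in
      new-round alice W≢∅ (own-move alice e′ v∈W (other v∈W (λ vβ → Bool.not-¬ refl (trans (sym vβ) vb))))
    -- With the independent block gone, `W` is the lockable block and it would be Bob's turn.
    ... | no ∅ = contradiction (trans (sym e′) (trans (cong (turn q ∘ ∣_∣)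
      (⊆-antisym {i = W} {j = W ∩ block β}
        (λ {u} u∈ → ∈-∩-block⁺ u∈ (decidable-stable (bl u Bool.≟ β) λ u≢ → ∅ (u , ∈-∩-block⁺ u∈ (Bool.¬-not u≢))))
        (proj₁ ∘ ∈-∩-block⁻))) e)) λ ()

  -- Locking one block leaves a single side of it and the other block untouched. The untouched block
  -- keeps its parity, which is what `lockable-independent` asks for.
  lockable-lockable : ∀ {W} → (∀ β → Lockable β W) → (∀ β → turn q ∣ W ∩ block β ∣ ≡ bob) →
    turn q ∣ W ∣ ≡ bob → Guarantee₀ alice 4 W
  lockable-lockable {W} lk e eW with nonempty? W
  ... | no W≡∅ = game-over alice W≡∅ z≤n
  ... | yes W≢∅ = new-round alice W≢∅ (any-move alice W≢∅ λ {v} v∈ →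
    alice-locks eW v∈ (lk (bl v) v∈ refl) λ R →
      let ag = locked-agree {β = not (bl v)} (Bool.not-¬ refl) R in
      lockable-independent (agree-lockable ag (lk (not (bl v))))
        (subst (λ γ → Independent γ _) (sym (Bool.not-involutive _)) (locked-independent R))
        (trans (cong (turn q ∘ ∣_∣) (sym (agree-∩ ag))) (e (not (bl v)))))

  -- Paired blocks and upper bounds under arbitrary play

  Partner : Fin m → Fin m → Set
  Partner v w = ix w ≡ ix v × sd w ≢ sd v

  partner-block : ∀ {v w} → Partner v w → bl w ≡ bl v
  partner-block (i , _) = cong inX i

  partner-after : ∀ {L v w} → w ∈ L → Partner v w → w ∈ after L v
  partner-after w∈ P@(i , s≢) = ∈-after⁺ w∈ (λ { refl → s≢ refl }) (nonadj⁺ (sym (partner-block P)) (inj₁ (sym i)))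

  -- Stated relative to `P` so that it applies to one block, to the whole vertex set and to the
  -- empty set. The field `unique` rules out twins inside `P`.
  record Paired (P : Subset m) (h : ℕ) (W : Subset m) : Set where
    field
      partner : ∀ {v} → v ∈ W → v ∈ P → ∃[ w ] (w ∈ W × w ∈ P × Partner v w)
      unique  : ∀ {u v} → u ∈ W → v ∈ W → u ∈ P → v ∈ P → ix u ≡ ix v → sd u ≡ sd v → u ≡ v
      size    : ∣ W ∩ P ∣ ≡ h ℕ.* 2

  open Paired

  paired-≢0 : ∀ {P h W v} → Paired P h W → v ∈ W → v ∈ P → ∃[ h′ ] h ≡ suc h′
  paired-≢0 {h = suc h} pd v∈ v∈P = h , refl
  paired-≢0 {h = zero} pd v∈ v∈P = contradiction (trans (sym (∣p-x∣ (x∈p∩q⁺ (v∈ , v∈P)))) (size pd)) λ ()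

  paired-only : ∀ {P h W v w x} → Paired P h W → v ∈ W → v ∈ P → w ∈ W → w ∈ P → Partner v w →
                x ∈ W → x ∈ P → ix x ≡ ix v → x ≡ v ⊎ x ≡ w
  paired-only {v = v} {x = x} pd v∈ v∈P w∈ w∈P (i , s≢) x∈ x∈P ix≡ with sd x Bool.≟ sd v
  ... | yes s = inj₁ (unique pd x∈ v∈ x∈P v∈P ix≡ s)
  ... | no s  = inj₂ (unique pd x∈ w∈ x∈P w∈P (trans ix≡ (sym i)) (≢-≢⇒≡ s s≢))

  paired-delete : ∀ {P h W v w} → Paired P (suc h) W → v ∈ W → v ∈ P → w ∈ W → w ∈ P → Partner v w →
                  Paired P h (W - v - w)
  paired-delete {P} {h} {W} {v} {w} pd v∈ v∈P w∈ w∈P pt@(i , s≢) = record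
    { partner = λ x∈ x∈P → let x∈Wv , x≢w = ∈-delete⁻ x∈ ; x∈W , x≢v = ∈-delete⁻ x∈Wv
                               y , y∈W , y∈P , yi , ys = partner pd x∈W x∈P
                               -- If the partner of `x` were deleted, `x` would share the index of
                               -- `v` and be one of the two deleted vertices itself.
                               y≢ : ∀ {z} → ix z ≡ ix v → y ≢ z
                               y≢ zi y≡z = [ x≢v , x≢w ]′ (paired-only pd v∈ v∈P w∈ w∈P pt x∈W x∈P
                                 (trans (sym yi) (trans (cong ix y≡z) zi)))
                           in y , x∈p∧x≢y⇒x∈p-y (x∈p∧x≢y⇒x∈p-y y∈W (y≢ refl)) (y≢ i) , y∈P , yi , ys
    ; unique = λ x∈ y∈ → unique pd (proj₁ (∈-delete⁻ (proj₁ (∈-delete⁻ x∈)))) (proj₁ (∈-delete⁻ (proj₁ (∈-delete⁻ y∈))))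
    ; size = trans (cong ∣_∣ (trans (delete-∩ (W - v) P w) (cong (_- w) (delete-∩ W P v))))
        (ℕ.suc-injective (ℕ.suc-injective (trans
          (sym (∣p-x-y∣ (x∈p∩q⁺ (v∈ , v∈P)) (x∈p∩q⁺ (w∈ , w∈P)) (λ { refl → s≢ refl }))) (size pd))))
    }

  -- The number of rounds the block can last, however the players move.
  data Budget (β : Bool) : ℕ → Subset m → Set where
    side  : ∀ {W} → Independent β W → Budget β 1 W
    pairs : ∀ {W h} → Paired (block β) h W → Budget β h W

  no-pairs : ∀ {β W} → (∀ {u} → u ∈ W → bl u ≢ β) → Budget β 0 W
  no-pairs {β} {W} none = pairs record
    { partner = λ v∈ b → contradiction (∈-⟪⟫⁻ (block? _) b) (none v∈)
    ; unique  = λ u∈ _ b → contradiction (∈-⟪⟫⁻ (block? _) b) (none u∈)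
    ; size    = trans (cong ∣_∣ (Empty-unique {p = W ∩ block β} λ (u , u∈) → let u∈W , b = ∈-∩-block⁻ u∈ in none u∈W b)) (∣⊥∣≡0 m)
    }

  agree-budget : ∀ {β k W W′} → Agree β W W′ → Budget β k W → Budget β k W′
  agree-budget ag (side indep) = side λ u∈ v∈ ub vb → indep (proj₂ (ag ub) u∈) (proj₂ (ag vb) v∈) ub vb
  agree-budget {β} ag (pairs pd) = pairs record
    { partner = λ v∈ b → let w , w∈ , w∈P , pt = partner pd (proj₂ (ag (from b)) v∈) b in
                w , proj₁ (ag (from w∈P)) w∈ , w∈P , pt
    ; unique  = λ u∈ v∈ ub vb → unique pd (proj₂ (ag (from ub)) u∈) (proj₂ (ag (from vb)) v∈) ub vb
    ; size    = trans (cong ∣_∣ (sym (agree-∩ ag))) (size pd)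
    }
    where
    from : ∀ {v} → v ∈ block β → bl v ≡ β
    from = ∈-⟪⟫⁻ (block? β)

  -- The second move decides. A partner ends the round at the cost of one pair; any other legal
  -- vertex locks a side and leaves an independent one, of budget `1`. Either way the budget drops.
  budget-round : ∀ {β k l n W v} →
    (∀ {W k l} → Budget β k W → Budget (not β) l W → k ℕ.+ l ≤ n → Guarantee₀ alice n W) →
    Budget β k W → Budget (not β) l W → k ℕ.+ l ≤ suc n → v ∈ W → bl v ≡ β → Round alice n W v
  budget-round hyp (side indep) B k+l v∈ refl = independent-round alice indep v∈ λ R →
    hyp (no-pairs (∈-pred R)) (agree-budget (other-agree (Bool.not-¬ refl) R) B) (ℕ.s≤s⁻¹ k+l)
  budget-round {n = n} {W} {v} hyp (pairs {h = h} pd) B k+l v∈ refl =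
    let w , w∈ , w∈P , pt = partner pd v∈ v∈P
    in any-move alice (w , partner-after w∈ pt) λ {u} u∈ → reply w∈ w∈P pt u∈ (ix u ℕ.≟ ix v)
    where
    v∈P : v ∈ block (bl v)
    v∈P = ∈-⟪⟫⁺ (block? _) refl
    reply : ∀ {w u} → w ∈ W → w ∈ block (bl v) → Partner v w → u ∈ after W v → Dec (ix u ≡ ix v) →
            Guarantee alice n (W - v - u) (after (after W v) u)
    reply {w} {u} w∈ w∈P (wi , ws) u∈ (yes i) with ∈-after⁻ u∈ | paired-≢0 pd v∈ v∈P
    ... | u∈W , u≢v , _ | h′ , refl = round-over alice (λ (x , x∈) → none x∈)
      (hyp (pairs (paired-delete pd v∈ v∈P u∈W u∈P pt))
        (agree-budget (λ b → (λ x∈ → x∈p∧x≢y⇒x∈p-y (x∈p∧x≢y⇒x∈p-y x∈ (apart refl b))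
                                       (apart (partner-block pt) b))
                            , proj₁ ∘ ∈-delete⁻ ∘ proj₁ ∘ ∈-delete⁻) B)
        (ℕ.s≤s⁻¹ k+l))
      where
      u∈P : u ∈ block (bl v)
      u∈P = ∈-⟪⟫⁺ (block? _) (cong inX i)
      pt : Partner v u
      pt = i , λ s → u≢v (unique pd u∈W v∈ u∈P v∈P i s)
      apart : ∀ {x y} → bl y ≡ bl v → bl x ≡ not (bl v) → x ≢ y
      apart y x refl = Bool.not-¬ y x
      -- A vertex nonadjacent to both partners cannot lie on both sides, so it shares their index
      -- and is one of them.
      none : ∀ {x} → ¬ x ∈ after (after W v) u
      none {x} x∈ with ∈-after⁻ x∈
      ... | x∈L , x≢u , ux with ∈-after⁻ x∈L
      ... | x∈W , x≢v , vx with nonadj⁻ vx | nonadj⁻ ux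
      ... | b , inj₁ e | _ = [ x≢v , x≢u ]′ (paired-only pd v∈ v∈P u∈W u∈P pt x∈W (∈-⟪⟫⁺ (block? _) (sym b)) (sym e))
      ... | b , inj₂ s | _ , inj₁ e = [ x≢v , x≢u ]′ (paired-only pd v∈ v∈P u∈W u∈P pt x∈W (∈-⟪⟫⁺ (block? _) (sym b)) (trans (sym e) i))
      ... | b , inj₂ s | _ , inj₂ s′ = proj₂ pt (trans s′ (sym s))
    reply {w} {u} w∈ w∈P (wi , ws) u∈ (no i≢) with ∈-after⁻ u∈
    ... | u∈W , u≢v , vu with nonadj⁻ vu
    ... | b , inj₁ e = contradiction (sym e) i≢
    ... | b , inj₂ s with two-pairs h (size pd)
      where
      -- Falling to budget `1` is a real drop only if `h ≥ 2`: the vertices `v`, `w`, `u` are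
      -- distinct and in the block, so `2h ≥ 3`.
      two-pairs : ∀ h → ∣ W ∩ block (bl v) ∣ ≡ h ℕ.* 2 → ∃[ h′ ] h ≡ 2 ℕ.+ h′
      two-pairs h e = go h (trans (sym e) (trans
        (∣p-x-y∣ (∈-∩-block⁺ v∈ refl) (∈-∩-block⁺ w∈ (cong inX wi)) (λ { refl → ws refl }))
        (cong (2 ℕ.+_) (∣p-x∣ (x∈p∧x≢y⇒x∈p-y (x∈p∧x≢y⇒x∈p-y (∈-∩-block⁺ u∈W (sym b)) u≢v)
          (λ { refl → i≢ wi }))))))
        where
        go : ∀ h {k} → h ℕ.* 2 ≡ 3 ℕ.+ k → ∃[ h′ ] h ≡ 2 ℕ.+ h′
        go (suc (suc h)) _ = h , refl
        go (suc zero) ()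
    ... | h′ , refl = lock-round alice (sym b , sym s) i≢ λ R →
      hyp (side (locked-independent R)) (agree-budget (locked-agree (Bool.not-¬ refl) R) B)
        (ℕ.≤-trans (s≤s (ℕ.m≤n+m _ h′)) (ℕ.s≤s⁻¹ k+l))

  any-play : ∀ n {W β k l} → Budget β k W → Budget (not β) l W → k ℕ.+ l ≤ n → Guarantee₀ alice n W
  any-play n {W} {β} {k} {l} B C k+l with nonempty? W
  ... | no W≡∅ = game-over alice W≡∅ z≤n
  any-play zero {W} {β} {k} {l} B C k+l | yes (v , v∈) = ⊥-elim (empty (bl v Bool.≟ β))
    where
    none : ∀ {γ k} → Budget γ k W → k ≡ 0 → bl v ≢ γ
    none (pairs pd) refl vb = contradiction (proj₂ (paired-≢0 pd v∈ (∈-⟪⟫⁺ (block? _) vb))) λ ()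
    empty : Dec (bl v ≡ β) → _
    empty (yes b) = none B (ℕ.n≤0⇒n≡0 (ℕ.m+n≤o⇒m≤o k k+l)) b
    empty (no b)  = none C (ℕ.n≤0⇒n≡0 (ℕ.m+n≤o⇒n≤o k k+l)) (Bool.¬-not b)
  any-play (suc n) {W} {β} {k} {l} B C k+l | yes W≢∅ = new-round alice W≢∅ (any-move alice W≢∅ λ {v} v∈ → round v∈ (bl v Bool.≟ β))
    where
    round : ∀ {v} → v ∈ W → Dec (bl v ≡ β) → Round alice n W v
    round v∈ (yes b) = budget-round (any-play n) B C k+l v∈ b
    round v∈ (no b)  = budget-round (any-play n) C (subst (λ γ → Budget γ k W) (sym (Bool.not-involutive β)) B)
      (subst (_≤ suc n) (ℕ.+-comm k l) k+l) v∈ (Bool.¬-not b)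

  -- Bob's replies and lower bounds

  -- Bob answers a move in P with its partner, which ends the round; outside P his moves are arbitrary.
  -- Alice moves first in each pair because Bob is never forced to open one: when it is his turn, an odd
  -- number of vertices remains outside P.
  module Reply (P : Subset m) (joined : ∀ {u v} → u ∈ P → v ∉ P → Adj u v) (q≡alice : Nonempty P → q ≡ alice) where

    -- The potential is `h` plus the order of `K`: a round opened inside `P` costs one pair, a round
    -- outside `P` at most one vertex of the clique.
    record Reserve (h : ℕ) (K W : Subset m) : Set where
      field
        paired : Paired P h W
        K⊆W    : ∀ {u} → u ∈ K → u ∈ W
        K∌P    : ∀ {u} → u ∈ K → u ∉ P
        clique : ∀ {u v} → u ∈ K → v ∈ K → u ≢ v → Adj u v

    open Reserve

    delete-unpaired : ∀ {h K W v} → v ∉ P → v ∉ K → Reserve h K W → Reserve h K (W - v)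
    delete-unpaired {W = W} {v} v∉P v∉K R = record
      { paired = record
        { partner = λ x∈ x∈P → let y , y∈ , y∈P , pt = partner (paired R) (proj₁ (∈-delete⁻ x∈)) x∈P in
            y , x∈p∧x≢y⇒x∈p-y y∈ (λ y≡v → v∉P (subst (_∈ P) y≡v y∈P)) , y∈P , pt
        ; unique = λ x∈ y∈ → unique (paired R) (proj₁ (∈-delete⁻ x∈)) (proj₁ (∈-delete⁻ y∈))
        ; size = trans (cong ∣_∣ (⊆-antisym
            (λ x∈ → let x∈Wv , x∈P = x∈p∩q⁻ (W - v) P x∈ in x∈p∩q⁺ (proj₁ (∈-delete⁻ x∈Wv) , x∈P))
            (λ x∈ → let x∈W , x∈P = x∈p∩q⁻ W P x∈ in
              x∈p∩q⁺ (x∈p∧x≢y⇒x∈p-y x∈W (λ { refl → v∉P x∈P }) , x∈P)))) (size (paired R))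
        }
      ; K⊆W = λ u∈ → x∈p∧x≢y⇒x∈p-y (K⊆W R u∈) λ { refl → v∉K u∈ }
      ; K∌P = K∌P R
      ; clique = clique R
      }

    shrink : ∀ {h K W} v → Reserve h K W → Reserve h (K - v) W
    shrink v R = record
      { paired = paired R
      ; K⊆W = K⊆W R ∘ proj₁ ∘ ∈-delete⁻
      ; K∌P = K∌P R ∘ proj₁ ∘ ∈-delete⁻
      ; clique = λ u∈ w∈ → clique R (proj₁ (∈-delete⁻ u∈)) (proj₁ (∈-delete⁻ w∈))
      }

    private
      smaller : ∀ {n} {W : Subset m} {v} → v ∈ W → ∣ W ∣ ≤ suc n → ∣ W - v ∣ ≤ n
      smaller v∈ le = ℕ.s≤s⁻¹ (ℕ.≤-trans (ℕ.≤-reflexive (sym (∣p-x∣ v∈))) le)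

      nonzero : ∀ {W : Subset m} {v} {A : Set} → v ∈ W → ∣ W ∣ ≤ 0 → A
      nonzero v∈ le = contradiction (ℕ.≤-trans (ℕ.≤-reflexive (sym (∣p-x∣ v∈))) le) λ ()

    -- The number `n` bounds the uncoloured set and drives the recursion. In `reserve-out` the
    -- current colour can no longer reach `K`; in `reserve-in` it still may take one vertex, hence
    -- the `suc b`.
    reserve₀ : ∀ n {h K W b} → ∣ W ∣ ≤ n → Reserve h K W → b ≤ h ℕ.+ ∣ K ∣ → Guarantee₀ bob b W
    reserve-out : ∀ n {h K W L b} → ∣ W ∣ ≤ n → Reserve h K W → b ≤ h ℕ.+ ∣ K ∣ →
      (∀ {x} → x ∈ L → x ∈ W × x ∉ P × x ∉ K) → Guarantee bob b W L
    reserve-in : ∀ n {h K W L b} → ∣ W ∣ ≤ n → Reserve h K W → suc b ≤ h ℕ.+ ∣ K ∣ →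
      (∀ {x} → x ∈ L → x ∈ W × x ∉ P) → Guarantee bob b W L
    reserve-move : ∀ n {h K W L v b} → ∣ W - v ∣ ≤ n → Reserve h K W → suc b ≤ h ℕ.+ ∣ K ∣ →
      (∀ {x} → x ∈ after L v → x ∈ W × x ∉ P) → v ∉ P → Guarantee bob b (W - v) (after L v)

    reserve-out n {L = L} ≤n R b≤ L⊆ with nonempty? L
    ... | no L≡∅ = round-over bob L≡∅ (reserve₀ n ≤n R b≤)
    reserve-out zero ≤n R b≤ L⊆ | yes (v , v∈) = nonzero (proj₁ (L⊆ v∈)) ≤n
    reserve-out (suc n) ≤n R b≤ L⊆ | yes L≢∅ = any-move bob L≢∅ λ v∈ →
      let v∈W , v∉P , v∉K = L⊆ v∈ in
      reserve-out n (smaller v∈W ≤n) (delete-unpaired v∉P v∉K R) b≤ λ x∈ →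
        let x∈L , x≢v , _ = ∈-after⁻ x∈ ; x∈W , x∉ = L⊆ x∈L in x∈p∧x≢y⇒x∈p-y x∈W x≢v , x∉

    reserve-in n {L = L} ≤n R b≤ L⊆ with nonempty? L
    ... | no L≡∅ = round-over bob L≡∅ (reserve₀ n ≤n R (ℕ.<⇒≤ b≤))
    reserve-in zero ≤n R b≤ L⊆ | yes (v , v∈) = nonzero (proj₁ (L⊆ v∈)) ≤n
    reserve-in (suc n) ≤n R b≤ L⊆ | yes L≢∅ = any-move bob L≢∅ λ v∈ →
      let v∈W , v∉P = L⊆ v∈ in
      reserve-move n (smaller v∈W ≤n) R b≤ (L⊆ ∘ proj₁ ∘ ∈-after⁻) v∉P

    reserve-move n {h} {K} {W} {L} {v} {b} ≤n R b≤ L⊆ v∉P with v ∈? K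
    ... | yes v∈K = reserve-out n ≤n (delete-unpaired v∉P (λ v∈ → proj₂ (∈-delete⁻ v∈) refl) (shrink v R))
      (ℕ.s≤s⁻¹ (ℕ.≤-trans b≤ (ℕ.≤-reflexive (trans (cong (h ℕ.+_) (∣p-x∣ v∈K)) (ℕ.+-suc h _)))))
      λ x∈ → let x∈W , x∉P = L⊆ x∈ ; _ , x≢v , vx = ∈-after⁻ x∈ in
        x∈p∧x≢y⇒x∈p-y x∈W x≢v , x∉P , λ x∈K → vx (clique R v∈K (proj₁ (∈-delete⁻ x∈K)) (x≢v ∘ sym))
    ... | no v∉K = reserve-in n ≤n (delete-unpaired v∉P v∉K R) b≤
      λ x∈ → let x∈W , x∉P = L⊆ x∈ ; _ , x≢v , vx = ∈-after⁻ x∈ in x∈p∧x≢y⇒x∈p-y x∈W x≢v , x∉P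

    reserve₀ n {b = zero} ≤n R b≤ S = z≤n
    reserve₀ n {h} {K} {W} {b = suc b} ≤n R b≤ with nonempty? W
    ... | no W≡∅ = game-over bob W≡∅ (ℕ.≤-trans b≤ (ℕ.≤-reflexive (cong₂ ℕ._+_ h≡0 K≡0)))
      where
      h≡0 : h ≡ 0
      h≡0 = ℕ.m*n≡0⇒m≡0 h 2 (trans (sym (size (paired R)))
        (trans (cong ∣_∣ (Empty-unique {p = W ∩ P} λ (x , x∈) → W≡∅ (x , proj₁ (x∈p∩q⁻ W P x∈)))) (∣⊥∣≡0 m)))
      K≡0 : ∣ K ∣ ≡ 0
      K≡0 = trans (cong ∣_∣ (Empty-unique {p = K} λ (x , x∈) → W≡∅ (x , K⊆W R x∈))) (∣⊥∣≡0 m)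
    reserve₀ zero {b = suc b} ≤n R b≤ | yes (v , v∈) = nonzero v∈ ≤n
    reserve₀ (suc n) {h} {K} {W} {b = suc b} ≤n R b≤ | yes W≢∅ = new-round bob W≢∅ (first (turn q ∣ W ∣) refl)
      where
      rest : ∀ {v} → v ∈ W → v ∉ P → Guarantee bob b (W - v) (after W v)
      rest v∈ v∉P = reserve-move n (smaller v∈ ≤n) R b≤
        (λ x∈ → let x∈W , _ , vx = ∈-after⁻ x∈ in x∈W , λ x∈P → vx (Graph.sym G (joined x∈P v∉P))) v∉P
      first : ∀ p → turn q ∣ W ∣ ≡ p → Guarantee bob b W W
      first bob e with nonempty? (W ─ P)
      ... | yes (v , v∈) = own-move bob e (∈-─⁻ v∈) (rest (∈-─⁻ v∈) (∉-─ v∈))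
      ... | no ∅ = contradiction (trans (sym e) (trans (cong (turn q) ∣W∣≡) (trans (turn-even q h)
              (q≡alice (proj₁ W≢∅ , in-P (proj₂ W≢∅)))))) λ ()
        where
        in-P : ∀ {x} → x ∈ W → x ∈ P
        in-P {x} x∈ = decidable-stable (x ∈? P) λ x∉ → ∅ (x , x∈p∧x∉q⇒x∈p─q x∈ x∉)
        ∣W∣≡ : ∣ W ∣ ≡ h ℕ.* 2
        ∣W∣≡ = trans (cong ∣_∣ (⊆-antisym {i = W} {j = W ∩ P}
          (λ x∈ → x∈p∩q⁺ (x∈ , in-P x∈)) (proj₁ ∘ x∈p∩q⁻ W P))) (size (paired R))
      first alice e = any-move bob W≢∅ λ {v} v∈ → reply v∈ (v ∈? P)
        where
        reply : ∀ {v} → v ∈ W → Dec (v ∈ P) → Guarantee bob b (W - v) (after W v)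
        reply v∈ (no v∉P) = rest v∈ v∉P
        reply {v} v∈ (yes v∈P) with partner (paired R) v∈ v∈P | paired-≢0 (paired R) v∈ v∈P
        ... | w , w∈ , w∈P , pt | h′ , refl =
          own-move bob (turn-delete q v∈ e)
            (partner-after w∈ pt)
            (round-over bob (λ (x , x∈) → none x∈)
              (reserve₀ n (smaller-two (smaller v∈ ≤n)) record
                { paired = paired-delete (paired R) v∈ v∈P w∈ w∈P pt
                ; K⊆W = λ u∈ → x∈p∧x≢y⇒x∈p-y (x∈p∧x≢y⇒x∈p-y (K⊆W R u∈)
                    (λ { refl → K∌P R u∈ v∈P })) (λ { refl → K∌P R u∈ w∈P })
                ; K∌P = K∌P R
                ; clique = clique R
                } (ℕ.s≤s⁻¹ b≤)))
          where
          smaller-two : ∣ W - v ∣ ≤ n → ∣ W - v - w ∣ ≤ n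
          smaller-two = ℕ.≤-trans (∣p─q∣≤∣p∣ (W - v) ⁅ w ⁆)
          none : ∀ {x} → ¬ x ∈ after (after W v) w
          none {x} x∈ with ∈-after⁻ x∈
          ... | x∈L , x≢w , wx with ∈-after⁻ x∈L
          ... | x∈W , x≢v , vx with nonadj⁻ vx | nonadj⁻ wx | decidable-stable (x ∈? P) (vx ∘ joined v∈P)
          ... | _ , inj₁ e | _ | x∈P = [ x≢v , x≢w ]′ (paired-only (paired R) v∈ v∈P w∈ w∈P pt x∈W x∈P (sym e))
          ... | _ , inj₂ s | _ , inj₁ e | x∈P =
            [ x≢v , x≢w ]′ (paired-only (paired R) v∈ v∈P w∈ w∈P pt x∈W x∈P (trans (sym e) (proj₁ pt)))
          ... | _ , inj₂ s | _ , inj₂ s′ | _ = proj₂ pt (trans s′ (sym s))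

  -- Cliques and lockability from labels

  weaken : ∀ {b b′ W} → b ≤ b′ → Guarantee₀ alice b W → Guarantee₀ alice b′ W
  weaken b≤ g S = ℕ.≤-trans (g S) b≤

  record Clique (k : ℕ) (K : Subset m) : Set where
    field
      order : ∣ K ∣ ≡ k
      adj   : ∀ {u v} → u ∈ K → v ∈ K → u ≢ v → Adj u v

  open Clique

  clique-⊥ : Clique 0 ⊥
  clique-⊥ = record { order = ∣⊥∣≡0 m ; adj = λ u∈ → ⊥-elim (∉⊥ u∈) }

  clique-insert : ∀ {k K v} → Clique k K → (∀ {u} → u ∈ K → Adj u v) → Clique (suc k) (K Subset.∪ ⁅ v ⁆)
  clique-insert {k} {K} {v} C av = record
    { order = trans (∣p-x∣ {p = K Subset.∪ ⁅ v ⁆} (x∈p∪q⁺ (inj₂ (x∈⁅x⁆ v)))) (cong suc (trans (cong ∣_∣ (⊆-antisym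
        (λ u∈ → let u∈∪ , u≢v = ∈-delete⁻ u∈ in
          [ id , (λ u∈v → contradiction (x∈⁅y⁆⇒x≡y v u∈v) u≢v) ]′ (x∈p∪q⁻ K ⁅ v ⁆ u∈∪))
        (λ u∈ → x∈p∧x≢y⇒x∈p-y (x∈p∪q⁺ (inj₁ u∈)) λ { refl → Graph.irrefl G refl (av u∈) }))) (order C)))
    ; adj = λ {u} {w} u∈ w∈ u≢w → go (split u∈) (split w∈) u≢w
    }
    where
    split : ∀ {u} → u ∈ K Subset.∪ ⁅ v ⁆ → u ∈ K ⊎ u ≡ v
    split u∈ = [ inj₁ , inj₂ ∘ x∈⁅y⁆⇒x≡y v ]′ (x∈p∪q⁻ K ⁅ v ⁆ u∈)
    go : ∀ {u w} → u ∈ K ⊎ u ≡ v → w ∈ K ⊎ w ≡ v → u ≢ w → Adj u w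
    go (inj₁ u∈)   (inj₁ w∈)   u≢w = adj C u∈ w∈ u≢w
    go (inj₁ u∈)   (inj₂ refl) _   = av u∈
    go (inj₂ refl) (inj₁ w∈)   _   = Graph.sym G (av w∈)
    go (inj₂ refl) (inj₂ refl) u≢w = contradiction refl u≢w

  ∈-insert⁻ : ∀ {P : Pred (Fin m) 0ℓ} {K v} → (∀ {u} → u ∈ K → P u) → P v → ∀ {u} → u ∈ K Subset.∪ ⁅ v ⁆ → P u
  ∈-insert⁻ {K = K} {v} PK Pv u∈ with x∈p∪q⁻ K ⁅ v ⁆ u∈
  ... | inj₁ u∈K = PK u∈K
  ... | inj₂ u∈v with x∈⁅y⁆⇒x≡y v u∈v
  ... | refl = Pv

  paired-⊤ : ∀ {P h} → (∀ {u v} → u ∈ P → ix v ≡ ix u → v ∈ P) →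
    (∀ {v} → v ∈ P → ∃[ w ] lab w ≡ (ix v , not (sd v))) →
    (∀ {u v} → u ∈ P → lab u ≡ lab v → u ≡ v) → ∣ ⊤ ∩ P ∣ ≡ h ℕ.* 2 → Paired P h ⊤
  paired-⊤ resp has inj size = record
    { partner = λ v∈ v∈P → let w , e = has v∈P in
        w , ∈⊤ , resp v∈P (cong proj₁ e) , cong proj₁ e , λ s → Bool.not-¬ refl (trans (sym s) (cong proj₂ e))
    ; unique = λ _ _ u∈P v∈P i s → inj u∈P (cong₂ _,_ i s)
    ; size = size
    }

  block-resp : ∀ {β u v} → u ∈ block β → ix v ≡ ix u → v ∈ block β
  block-resp {β} u∈ e = ∈-⟪⟫⁺ (block? β) (trans (cong inX e) (∈-⟪⟫⁻ (block? β) u∈))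

  -- Two full pairs suffice: one of the two indices differs from that of the vertex played, and its
  -- pair has a vertex on either side.
  lockable : ∀ {β W} a → (∀ {i s} → i ≡ a ⊎ i ≡ suc a → ∃[ v ] (v ∈ W × lab v ≡ (i , s))) →
             inX a ≡ β → inX (suc a) ≡ β → Lockable β W
  lockable a has aβ sβ {v} v∈ vβ with ix v ℕ.≟ a
  ... | yes i = let w , w∈ , e = has (inj₂ refl) in
    w , w∈ , (trans (cong (inX ∘ proj₁) e) (trans sβ (sym vβ)) , cong proj₂ e)
      , λ e′ → ℕ.1+n≢n (trans (sym (cong proj₁ e)) (trans e′ i))
  ... | no i≢ = let w , w∈ , e = has (inj₁ refl) in
    w , w∈ , (trans (cong (inX ∘ proj₁) e) (trans aβ (sym vβ)) , cong proj₂ e)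
      , λ e′ → i≢ (trans (sym e′) (cong proj₁ e))

  block-clique : ∀ a i {β k K} → Clique k K → (∀ {u} → u ∈ K → bl u ≢ β × ix u ≢ i) →
    (∀ c → c ≤ 2 → inX (c ℕ.+ a) ≡ β) →
    (∀ c s → c ≤ 2 → c ℕ.+ a ≢ i → ∃[ v ] lab v ≡ (c ℕ.+ a , s)) →
    ∃[ K′ ] (Clique (2 ℕ.+ k) K′ × (∀ {u} → u ∈ K′ → (u ∈ K ⊎ bl u ≡ β) × ix u ≢ i))
  block-clique a i {β} {k} {K} C out inβ has with two-others a i
  ... | c , d , c≤ , d≤ , c≢d , c≢i , d≢i with has c false c≤ c≢i | has d true d≤ d≢i
  ... | v , ev | w , ew = _
    , clique-insert {v = w} (clique-insert {v = v} C (λ u∈ → apart u∈ vβ)) (∈-insert⁻ {λ u → Adj u w} {K = K} (λ u∈ → apart u∈ wβ)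
        (adj⁺ (inj₂ ((λ e → c≢d (ℕ.+-cancelʳ-≡ a c d (trans (sym (cong proj₁ ev)) (trans e (cong proj₁ ew)))))
          , λ e → contradiction (trans (sym (cong proj₂ ev)) (trans e (cong proj₂ ew))) λ ()))))
    , ∈-insert⁻ {Good} {K = K Subset.∪ ⁅ v ⁆} (∈-insert⁻ {Good} {K = K} (λ u∈ → inj₁ u∈ , proj₂ (out u∈))
        (inj₂ vβ , λ e → c≢i (trans (sym (cong proj₁ ev)) e)))
        (inj₂ wβ , λ e → d≢i (trans (sym (cong proj₁ ew)) e))
    where
    Good : Pred (Fin m) 0ℓ
    Good u = (u ∈ K ⊎ bl u ≡ β) × ix u ≢ i
    vβ = trans (cong (inX ∘ proj₁) ev) (inβ c c≤)
    wβ = trans (cong (inX ∘ proj₁) ew) (inβ d d≤)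
    apart : ∀ {u x} → u ∈ K → bl x ≡ β → Adj u x
    apart u∈ xβ = adj⁺ (inj₁ λ e → proj₁ (out u∈) (trans e xβ))

  -- An edge inside each block, and the blocks are joined. Avoiding `i` makes the clique survive a
  -- deletion in pair `i`, or a round confined to that index.
  clique-4 : ∀ i → (∀ c s a → c ≤ 2 → a ≡ 0 ⊎ a ≡ 4 → c ℕ.+ a ≢ i → ∃[ v ] lab v ≡ (c ℕ.+ a , s)) →
             ∃[ K ] (Clique 4 K × (∀ {u} → u ∈ K → ix u ≢ i))
  clique-4 i has with block-clique 0 i clique-⊥ (λ u∈ → ⊥-elim (∉⊥ u∈)) inX-low (λ c s c≤ → has c s 0 c≤ (inj₁ refl))
  ... | K , C , good with block-clique 4 i C
      (λ u∈ → (λ f → contradiction (trans (sym f) ([ (λ u∈⊥ → ⊥-elim (∉⊥ u∈⊥)) , id ]′ (proj₁ (good u∈)))) λ ()) , proj₂ (good u∈))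
      (λ c _ → inX-high c) (λ c s c≤ → has c s 4 c≤ (inj₂ refl))
  ... | K′ , C′ , good′ = K′ , C′ , proj₂ ∘ good′

  paired-⊥ : ∀ {W} → Paired ⊥ 0 W
  paired-⊥ {W} = record
    { partner = λ _ v∈ → ⊥-elim (∉⊥ v∈)
    ; unique  = λ _ _ u∈ → ⊥-elim (∉⊥ u∈)
    ; size    = trans (cong ∣_∣ (∩-zeroʳ W)) (∣⊥∣≡0 m)
    }

  -- With no pairs to guard, Bob can play anything: each round colours at most one vertex of the
  -- clique.
  module _ {k : ℕ} {K W : Subset m} (C : Clique k K) (K⊆W : ∀ {u} → u ∈ K → u ∈ W) where
    private
      module Unpaired = Reply ⊥ (λ u∈ → ⊥-elim (∉⊥ u∈)) (λ (_ , u∈) → ⊥-elim (∉⊥ u∈))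

      reserve : Unpaired.Reserve 0 K W
      reserve = record { paired = paired-⊥ ; K⊆W = K⊆W ; K∌P = λ _ → ∉⊥ ; clique = adj C }

    clique-lower : Guarantee₀ bob k W
    clique-lower = Unpaired.reserve₀ ∣ W ∣ ℕ.≤-refl reserve (ℕ.≤-reflexive (sym (order C)))

    clique-untouched : ∀ {L} → (∀ {x} → x ∈ L → x ∈ W × x ∉ K) → Guarantee bob k W L
    clique-untouched L⊆ = Unpaired.reserve-out ∣ W ∣ ℕ.≤-refl reserve (ℕ.≤-reflexive (sym (order C)))
      λ x∈ → let x∈W , x∉K = L⊆ x∈ in x∈W , ∉⊥ , x∉K

  -- The value of the whole graph

  module Whole {N k : ℕ} (N≡4+k : N ≡ 4 ℕ.+ k) (3≤k : 3 ≤ k) (q≡bob : q ≡ bob) (alice-starts : turn q m ≡ alice)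
    (lab-< : ∀ v → ix v ℕ.< N) (surjective : ∀ i s → i ℕ.< N → ∃[ v ] lab v ≡ (i , s))
    (injective : ∀ {u v} → lab u ≡ lab v → lab u ≢ (0 , true) → u ≡ v)
    (∣X∖0∣ : ∣ ⟪ nonzeroInX? ∘ lab ⟫ ∣ ≡ 3 ℕ.* 2) (∣Y∣ : ∣ block false ∣ ≡ k ℕ.* 2) where

    open Indices N≡4+k 3≤k

    turn-⊤ : turn q ∣ ⊤ {m} ∣ ≡ alice
    turn-⊤ = trans (cong (turn q) (∣⊤∣≡n m)) alice-starts

    even-bob : ∀ {n} h → n ≡ h ℕ.* 2 → turn q n ≡ bob
    even-bob h e = trans (cong (turn q) e) (trans (turn-even q h) q≡bob)

    ∣⊤∩block∣ : ∀ β → ∣ ⊤ ∩ block β ∣ ≡ ∣ block β ∣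
    ∣⊤∩block∣ β = cong ∣_∣ (∩-identityˡ (block β))

    lockable-Y : Lockable false ⊤
    lockable-Y = lockable 4 (λ i∈ → let v , e = surjective _ _ (two-low ℕ.≤-refl i∈) in v , ∈⊤ , e) refl refl

    upper : χᴬᴮ G ≤ 5
    upper with surjective 0 false 0<N | surjective 0 true 0<N
    -- Alice opens with `x₀`, the common partner of the twins; the twin `y₀` witnesses that the
    -- round is not over.
    ... | x₀ , e₀ | y₀ , e₁ = initial alice alice-starts
      (new-round alice (x₀ , ∈⊤) (own-move alice turn-⊤ ∈⊤ (any-move alice
        (y₀ , partner-after ∈⊤ (trans (cong proj₁ e₁) (sym (cong proj₁ e₀)) ,
          λ s → contradiction (trans (sym (cong proj₂ e₁)) (trans s (cong proj₂ e₀))) λ ()))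
        λ {u} u∈ → reply u∈ (ix u ℕ.≟ 0))))
      where
      reply : ∀ {u} → u ∈ after ⊤ x₀ → Dec (ix u ≡ 0) →
              Guarantee alice 4 (⊤ - x₀ - u) (after (after ⊤ x₀) u)
      -- A reply at another index lies on the side of `x₀`, so Bob locks that side himself and three
      -- more rounds suffice.
      reply {u} u∈ (no u≢0) with ∈-after⁻ u∈
      ... | _ , _ , ¬a with nonadj⁻ ¬a
      ... | b , inj₁ i = contradiction (trans (sym i) (cong proj₁ e₀)) u≢0
      ... | b , inj₂ s = lock-round alice (sym b , sym s) (λ e → u≢0 (trans e (cong proj₁ e₀))) λ {W′} R →
        let ag : Agree false ⊤ W′
            ag = locked-agree {v = x₀} (λ f → contradiction (trans (sym (cong (inX ∘ proj₁) e₀)) f) λ ()) R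
        in weaken (ℕ.n≤1+n 3) (lockable-independent {false} {W′} (agree-lockable {false} {⊤} {W′} ag lockable-Y)
          (subst (λ γ → Independent γ W′) (cong (inX ∘ proj₁) e₀) (locked-independent {v = x₀} R))
          (even-bob k (trans (cong ∣_∣ (sym (agree-∩ {false} {⊤} {W′} ag))) (trans (∣⊤∩block∣ false) ∣Y∣))))
      -- Bob took a twin, and only vertices of index `0` stay legal, which forces the other one.
      -- Then `3 + k` full pairs remain, and the even number puts Bob on move.
      reply {u} u∈ (yes u≡0) = finish alice
        (λ x∈ y∈ → nonadj⁺ (cong inX (trans (L⇒0 x∈) (sym (L⇒0 y∈)))) (inj₁ (trans (L⇒0 x∈) (sym (L⇒0 y∈)))))
        (lockable-lockable lock (λ { true → even-bob 3 size-X
                                   ; false → even-bob k size-Y })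
          (even-bob (3 ℕ.+ k) size-W))
        where
        L W : Subset m
        L = after (after ⊤ x₀) u
        W = (⊤ - x₀ - u) ─ L
        u≢x₀ : u ≢ x₀
        u≢x₀ = proj₁ (proj₂ (∈-after⁻ {⊤} {x₀} u∈))
        sd-u : sd u ≢ sd x₀
        sd-u s = u≢x₀ (injective (cong₂ _,_ (trans u≡0 (sym (cong proj₁ e₀))) s)
          λ e → contradiction (trans (sym (cong proj₂ e)) (trans s (cong proj₂ e₀))) λ ())
        L⇒0 : ∀ {x} → x ∈ L → ix x ≡ 0
        L⇒0 x∈ with ∈-after⁻ x∈
        ... | x∈L , _ , ux with ∈-after⁻ x∈L
        ... | _ , _ , vx with nonadj⁻ vx | nonadj⁻ ux
        ... | _ , inj₁ i | _ = trans (sym i) (cong proj₁ e₀)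
        ... | _ , inj₂ s | _ , inj₁ i = trans (sym i) u≡0
        ... | _ , inj₂ s | _ , inj₂ s′ = contradiction (trans s′ (sym s)) sd-u
        W⇒≢0 : ∀ {x} → x ∈ W → ix x ≢ 0
        W⇒≢0 {x} x∈ i = let x∈⊤x₀ , x≢u = ∈-delete⁻ (∈-─⁻ x∈) ; _ , x≢x₀ = ∈-delete⁻ x∈⊤x₀ in
          ∉-─ x∈ (∈-after⁺ (∈-after⁺ ∈⊤ x≢x₀ (same (trans (cong proj₁ e₀) (sym i)))) x≢u (same (trans u≡0 (sym i))))
          where
          same : ∀ {y z} → ix y ≡ ix z → ¬ Adj y z
          same e = nonadj⁺ (cong inX e) (inj₁ e)
        ≢0⇒W : ∀ {x} → ix x ≢ 0 → x ∈ W
        ≢0⇒W i≢ = x∈p∧x∉q⇒x∈p─q (x∈p∧x≢y⇒x∈p-y (x∈p∧x≢y⇒x∈p-y ∈⊤ λ { refl → i≢ (cong proj₁ e₀) })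
          λ { refl → i≢ u≡0 }) (i≢ ∘ L⇒0)
        lock : ∀ β → Lockable β W
        lock true = lockable 1 (λ i∈ → let v , e = surjective _ _ (two-low (s≤s z≤n) i∈) in
            v , ≢0⇒W (λ e′ → nz i∈ (trans (sym (cong proj₁ e)) e′)) , e) refl refl
          where
          nz : ∀ {i} → i ≡ 1 ⊎ i ≡ 2 → i ≢ 0
          nz (inj₁ refl) ()
          nz (inj₂ refl) ()
        lock false = agree-lockable
          (λ b → (λ _ → ≢0⇒W λ e → contradiction (trans (sym b) (cong inX e)) λ ()) , λ _ → ∈⊤) lockable-Y
        size-Y : ∣ W ∩ block false ∣ ≡ k ℕ.* 2
        size-Y = trans (cong ∣_∣ (sym (agree-∩ {false} {⊤} {W}
          (λ b → (λ _ → ≢0⇒W λ e → contradiction (trans (sym b) (cong inX e)) λ ()) , λ _ → ∈⊤))))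
          (trans (∣⊤∩block∣ false) ∣Y∣)
        size-X : ∣ W ∩ block true ∣ ≡ 3 ℕ.* 2
        size-X = trans (cong ∣_∣ (⊆-antisym {j = ⟪ nonzeroInX? ∘ lab ⟫}
            (λ x∈ → let x∈W , b = ∈-∩-block⁻ x∈ in ∈-⟪⟫⁺ (nonzeroInX? ∘ lab) (b , W⇒≢0 x∈W))
            (λ x∈ → let b , i≢ = ∈-⟪⟫⁻ (nonzeroInX? ∘ lab) x∈ in ∈-∩-block⁺ (≢0⇒W i≢) b)))
          ∣X∖0∣
        size-W : ∣ W ∣ ≡ (3 ℕ.+ k) ℕ.* 2
        size-W = trans (∣p∩q∣+∣p─q∣ W (block true)) (cong₂ ℕ._+_ size-X (trans (cong ∣_∣ (⊆-antisym {j = W ∩ block false}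
          (λ x∈ → ∈-∩-block⁺ (∈-─⁻ x∈) (Bool.¬-not (∉-─ x∈ ∘ ∈-⟪⟫⁺ (block? true))))
          (λ x∈ → let x∈W , b = ∈-∩-block⁻ x∈ in
            x∈p∧x∉q⇒x∈p─q x∈W λ x∈X → contradiction (trans (sym b) (∈-⟪⟫⁻ (block? true) x∈X)) λ ()))) size-Y))

    -- Bob answers `v` with the opposite label, confining the first round to one index. A clique of
    -- order four avoiding that index is left for four further rounds.
    lower : 5 ≤ χᴬᴮ G
    lower with surjective 0 true 0<N
    ... | y₀ , _ = initial bob alice-starts
      (new-round bob (y₀ , ∈⊤) (any-move bob (y₀ , ∈⊤) λ {v} _ → reply v))
      where
      answer : ∀ v w → lab w ≡ (ix v , not (sd v)) →
        ∃[ K ] (Clique 4 K × (∀ {u} → u ∈ K → ix u ≢ ix v)) → Round bob 4 ⊤ v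
      answer v w e (K , C , K≢) = own-move bob
        (turn-delete q {v = v} ∈⊤ turn-⊤)
        (partner-after ∈⊤ pt)
        (clique-untouched C
          (λ u∈ → x∈p∧x≢y⇒x∈p-y (x∈p∧x≢y⇒x∈p-y ∈⊤ λ { refl → K≢ u∈ refl }) λ { refl → K≢ u∈ (proj₁ pt) })
          λ x∈ → let x∈L , x≢w , _ = ∈-after⁻ x∈ ; x∈⊤ , x≢v , _ = ∈-after⁻ x∈L in
            x∈p∧x≢y⇒x∈p-y (x∈p∧x≢y⇒x∈p-y x∈⊤ x≢v) x≢w , λ x∈K → K≢ x∈K (same x∈))
        where
        pt : Partner v w
        pt = cong proj₁ e , λ s → Bool.not-¬ refl (trans (sym s) (cong proj₂ e))
        same : ∀ {x} → x ∈ after (after ⊤ v) w → ix x ≡ ix v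
        same x∈ with ∈-after⁻ x∈
        ... | x∈L , _ , wx with ∈-after⁻ x∈L
        ... | _ , _ , vx with nonadj⁻ vx | nonadj⁻ wx
        ... | _ , inj₁ i | _ = sym i
        ... | _ , inj₂ s | _ , inj₁ i = trans (sym i) (proj₁ pt)
        ... | _ , inj₂ s | _ , inj₂ s′ = contradiction (trans s′ (sym s)) (proj₂ pt)
      reply : ∀ v → Round bob 4 ⊤ v
      reply v = let w , e = surjective (ix v) (not (sd v)) (lab-< v) in
        answer v w e (clique-4 (ix v) (λ c s a c≤ a∈ _ → surjective _ s (low c a c≤ a∈)))

  -- Vertex-deleted graphs

  module Deleted {N k : ℕ} (N≡4+k : N ≡ 4 ℕ.+ k) (3≤k : 3 ≤ k) (q≡alice : q ≡ alice) (alice-starts : turn q m ≡ alice)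
    (gone : Label) (gone-< : proj₁ gone ℕ.< N)
    (lab-< : ∀ v → ix v ℕ.< N) (surjective : ∀ i s → i ℕ.< N → gone ≢ (i , s) → ∃[ v ] lab v ≡ (i , s))
    (injective : ∀ {u v} → lab u ≡ lab v → lab u ≢ (0 , true) → u ≡ v) where

    open Indices N≡4+k 3≤k

    turn-⊤ : turn q ∣ ⊤ {m} ∣ ≡ alice
    turn-⊤ = trans (cong (turn q) (∣⊤∣≡n m)) alice-starts

    ∣⊤∩block∣ : ∀ β → ∣ ⊤ ∩ block β ∣ ≡ ∣ block β ∣
    ∣⊤∩block∣ β = cong ∣_∣ (∩-identityˡ (block β))

    -- The witness is the partner of the deleted vertex: since no vertex carries `gone`, its index
    -- occurs on one side only.
    solo : (∀ u → lab u ≢ gone) → ∃[ v ] (bl v ≡ inX (proj₁ gone) × (∀ {u} → u ∈ ⊤ → ix u ≡ ix v → sd u ≡ sd v))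
    solo missing with surjective (proj₁ gone) (not (proj₂ gone)) gone-< (λ e → Bool.not-¬ refl (cong proj₂ e))
    ... | v , e = v , cong (inX ∘ proj₁) e , λ {u} _ i → trans
      (Bool.¬-not (λ s → missing u (cong₂ _,_ (trans i (cong proj₁ e)) s))) (sym (cong proj₂ e))

    nonempty : Nonempty (⊤ {m})
    nonempty with gone ≟ₗ (0 , true)
    ... | no g≢  = proj₁ (surjective 0 true 0<N g≢) , ∈⊤
    ... | yes g≡ = proj₁ (surjective 0 false 0<N λ e → contradiction (trans (sym (cong proj₂ g≡)) (cong proj₂ e)) λ ()) , ∈⊤

    pairs-Y : inX (proj₁ gone) ≡ true → ∣ block false ∣ ≡ k ℕ.* 2 → Paired (block false) k ⊤
    pairs-Y b ∣Y∣ = paired-⊤ (block-resp {false})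
      (λ {v} v∈ → surjective (ix v) (not (sd v)) (lab-< v)
        λ e → contradiction (trans (sym b) (trans (cong (inX ∘ proj₁) e) (∈-⟪⟫⁻ (block? false) v∈))) λ ())
      (λ v∈ e → injective e λ e′ → contradiction (trans (sym (cong (inX ∘ proj₁) e′)) (∈-⟪⟫⁻ (block? false) v∈)) λ ())
      (trans (∣⊤∩block∣ false) ∣Y∣)

    in-Y-upper : inX (proj₁ gone) ≡ false → (∀ u → lab u ≢ gone) → turn q ∣ block true ∣ ≡ bob → χᴬᴮ G ≤ 4
    in-Y-upper b missing odd with solo missing
    ... | v , vb , alone = initial alice alice-starts (new-round alice nonempty (own-move alice turn-⊤ ∈⊤
      (solo-round alice {v = v} alone λ {W′} R →
        let ag : Agree true ⊤ W′
            ag = locked-agree {v = v} (λ t → contradiction (trans (sym b) (trans (sym vb) t)) λ ()) R in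
        lockable-independent {true} {W′}
          (agree-lockable {true} {⊤} {W′} ag (lockable 1 others refl refl))
          (subst (λ γ → Independent γ W′) (trans vb b) (locked-independent {v = v} R))
          (trans (cong (turn q) (trans (cong ∣_∣ (sym (agree-∩ {true} {⊤} {W′} ag))) (∣⊤∩block∣ true))) odd))))
      where
      in-X : ∀ {i} → i ≡ 1 ⊎ i ≡ 2 → inX i ≡ true
      in-X (inj₁ refl) = refl
      in-X (inj₂ refl) = refl
      others : ∀ {i s} → i ≡ 1 ⊎ i ≡ 2 → ∃[ u ] (u ∈ ⊤ × lab u ≡ (i , s))
      others {i} {s} i∈ with surjective i s (two-low (s≤s z≤n) i∈)
        (λ e → contradiction (trans (sym b) (trans (cong (inX ∘ proj₁) e) (in-X i∈))) λ ())
      ... | u , e = u , ∈⊤ , e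

    in-Y-lower : 4 ≤ χᴬᴮ G
    in-Y-lower = let K , C , _ = clique-4 (proj₁ gone)
                       (λ c s a c≤ a∈ c≢ → surjective (c ℕ.+ a) s (low c a c≤ a∈) (c≢ ∘ sym ∘ cong proj₁))
                 in initial bob alice-starts (clique-lower C (λ _ → ∈⊤))

    -- One round for the side of the vertex left without partner, one for the opposite side of `X`,
    -- and at most `k` for `Y` however it is played.
    in-X-upper : inX (proj₁ gone) ≡ true → (∀ u → lab u ≢ gone) → ∣ block false ∣ ≡ k ℕ.* 2 → χᴬᴮ G ≤ 2 ℕ.+ k
    in-X-upper b missing ∣Y∣ with solo missing
    ... | v , vb , alone = initial alice alice-starts (new-round alice nonempty (own-move alice turn-⊤ ∈⊤
      (solo-round alice {v = v} alone λ {W′} R → any-play (1 ℕ.+ k) {W′} {true}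
        (side (subst (λ γ → Independent γ W′) (trans vb b) (locked-independent {v = v} R)))
        (agree-budget {W = ⊤} (locked-agree {v = v} (λ f → contradiction (trans (sym b) (trans (sym vb) f)) λ ()) R) (pairs (pairs-Y b ∣Y∣)))
        ℕ.≤-refl)))

    -- Bob guards the `k` pairs of `Y` as `P` and keeps an edge of `X` as the clique, worth two more
    -- rounds.
    in-X-lower : inX (proj₁ gone) ≡ true → ∣ block false ∣ ≡ k ℕ.* 2 → 2 ℕ.+ k ≤ χᴬᴮ G
    in-X-lower b ∣Y∣ with block-clique 0 (proj₁ gone) {β = true} clique-⊥ (λ u∈ → ⊥-elim (∉⊥ u∈)) inX-low
      (λ c s c≤ c≢ → surjective (c ℕ.+ 0) s (low c 0 c≤ (inj₁ refl)) (c≢ ∘ sym ∘ cong proj₁))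
    ... | K , C , good = initial bob alice-starts (reserve₀ m (ℕ.≤-reflexive (∣⊤∣≡n m)) record
          { paired = pairs-Y b ∣Y∣
          ; K⊆W = λ _ → ∈⊤
          ; K∌P = λ u∈ u∈Y → contradiction (trans (sym ([ (λ u∈⊥ → ⊥-elim (∉⊥ u∈⊥)) , id ]′ (proj₁ (good u∈)))) (∈-⟪⟫⁻ (block? false) u∈Y)) λ ()
          ; clique = Clique.adj C
          } (ℕ.≤-reflexive (trans (ℕ.+-comm 2 k) (cong (k ℕ.+_) (sym (Clique.order C))))))
      where
      open Reply (block false)
        (λ u∈ v∉ → adj⁺ (inj₁ λ e → v∉ (∈-⟪⟫⁺ (block? false) (trans (sym e) (∈-⟪⟫⁻ (block? false) u∈)))))
        (λ _ → q≡alice)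

  module Perfect {N k : ℕ} (N≡4+k : N ≡ 4 ℕ.+ k) (q≡alice : q ≡ alice) (alice-starts : turn q m ≡ alice) (m≡ : m ≡ N ℕ.* 2)
    (lab-< : ∀ v → ix v ℕ.< N) (surjective : ∀ i s → i ℕ.< N → ∃[ v ] lab v ≡ (i , s))
    (injective : ∀ {u v} → lab u ≡ lab v → u ≡ v) where

    all-paired : ∀ P {h} → (∀ {u v} → u ∈ P → ix v ≡ ix u → v ∈ P) → ∣ P ∣ ≡ h ℕ.* 2 → Paired P h ⊤
    all-paired P resp size = paired-⊤ resp (λ {v} _ → surjective (ix v) _ (lab-< v)) (λ _ → injective)
      (trans (cong ∣_∣ (∩-identityˡ P)) size)

    perfect-upper : ∣ block true ∣ ≡ 4 ℕ.* 2 → ∣ block false ∣ ≡ k ℕ.* 2 → χᴬᴮ G ≤ 4 ℕ.+ k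
    perfect-upper ∣X∣ ∣Y∣ = initial alice alice-starts (any-play (4 ℕ.+ k) {⊤} {true} {4} {k}
      (pairs (all-paired (block true) (block-resp {true}) ∣X∣)) (pairs (all-paired (block false) (block-resp {false}) ∣Y∣)) ℕ.≤-refl)

    -- The reply strategy governs the whole vertex set, so every pair costs its own round.
    perfect-lower : 4 ℕ.+ k ≤ χᴬᴮ G
    perfect-lower = initial bob alice-starts (reserve₀ m {K = ⊥} (ℕ.≤-reflexive (∣⊤∣≡n m)) record
        { paired = all-paired ⊤ (λ _ _ → ∈⊤) (trans (∣⊤∣≡n m) m≡)
        ; K⊆W = λ _ → ∈⊤
        ; K∌P = λ u∈ → ⊥-elim (∉⊥ u∈)
        ; clique = λ u∈ → ⊥-elim (∉⊥ u∈)
        } (ℕ.≤-trans (ℕ.≤-reflexive (sym N≡4+k)) (ℕ.m≤m+n N _)))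
      where
      open Reply ⊤ (λ _ v∉ → ⊥-elim (v∉ ∈⊤)) (λ _ → q≡alice)

-- The concrete labelling and counting

pairLab : ∀ N → Fin (N ℕ.* 2) → Label
pairLab (suc h) zero          = h , false
pairLab (suc h) (suc zero)    = h , true
pairLab (suc h) (suc (suc v)) = pairLab h v

pairLab-< : ∀ N v → proj₁ (pairLab N v) ℕ.< N
pairLab-< (suc h) zero          = ℕ.n<1+n h
pairLab-< (suc h) (suc zero)    = ℕ.n<1+n h
pairLab-< (suc h) (suc (suc v)) = ℕ.m<n⇒m<1+n (pairLab-< h v)

pairLab-injective : ∀ N {u v} → pairLab N u ≡ pairLab N v → u ≡ v
pairLab-injective (suc h) {zero}        {zero}        e = refl
pairLab-injective (suc h) {zero}        {suc zero}    ()
pairLab-injective (suc h) {zero}        {suc (suc v)} e = contradiction (sym (cong proj₁ e)) (ℕ.<⇒≢ (pairLab-< h v))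
pairLab-injective (suc h) {suc zero}    {zero}        ()
pairLab-injective (suc h) {suc zero}    {suc zero}    e = refl
pairLab-injective (suc h) {suc zero}    {suc (suc v)} e = contradiction (sym (cong proj₁ e)) (ℕ.<⇒≢ (pairLab-< h v))
pairLab-injective (suc h) {suc (suc u)} {zero}        e = contradiction (cong proj₁ e) (ℕ.<⇒≢ (pairLab-< h u))
pairLab-injective (suc h) {suc (suc u)} {suc zero}    e = contradiction (cong proj₁ e) (ℕ.<⇒≢ (pairLab-< h u))
pairLab-injective (suc h) {suc (suc u)} {suc (suc v)} e = cong (λ x → suc (suc x)) (pairLab-injective h e)

pairLab-surjective : ∀ N i s → i ℕ.< N → ∃[ v ] pairLab N v ≡ (i , s)
pairLab-surjective (suc h) i s (s≤s i≤h) with i ℕ.≟ h | s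
... | yes refl | false = zero , refl
... | yes refl | true  = suc zero , refl
... | no i≢h   | s     = let v , e = pairLab-surjective h i s (ℕ.≤∧≢⇒< i≤h i≢h) in suc (suc v) , e

weight : Bool → ℕ
weight b = if b then 1 else 0

∣tabulate-suc∣ : (f : Fin (suc m) → Bool) → ∣ tabulate f ∣ ≡ weight (f zero) ℕ.+ ∣ tabulate (f ∘ suc) ∣
∣tabulate-suc∣ f with f zero
... | true  = refl
... | false = refl

∣tabulate-punchIn∣ : (f : Fin (suc m) → Bool) (x : Fin (suc m)) →
                     ∣ tabulate f ∣ ≡ weight (f x) ℕ.+ ∣ tabulate (f ∘ punchIn x) ∣
∣tabulate-punchIn∣ f zero = ∣tabulate-suc∣ f
∣tabulate-punchIn∣ {suc m} f (suc x) = begin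
  ∣ tabulate f ∣
    ≡⟨ ∣tabulate-suc∣ f ⟩
  weight (f zero) ℕ.+ ∣ tabulate (f ∘ suc) ∣
    ≡⟨ cong (weight (f zero) ℕ.+_) (∣tabulate-punchIn∣ (f ∘ suc) x) ⟩
  weight (f zero) ℕ.+ (weight (f (suc x)) ℕ.+ ∣ tabulate (f ∘ suc ∘ punchIn x) ∣)
    ≡⟨ x∙yz≈y∙xz (weight (f zero)) (weight (f (suc x))) _ ⟩
  weight (f (suc x)) ℕ.+ (weight (f zero) ℕ.+ ∣ tabulate (f ∘ suc ∘ punchIn x) ∣)
    ≡⟨ cong (weight (f (suc x)) ℕ.+_) (∣tabulate-suc∣ (f ∘ punchIn (suc x))) ⟨
  weight (f (suc x)) ℕ.+ ∣ tabulate (f ∘ punchIn (suc x)) ∣ ∎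
  where
  open ≡-Reasoning
  open import Algebra.Properties.CommutativeSemigroup ℕ.+-commutativeSemigroup using (x∙yz≈y∙xz)

-- Since `pairLab` lists the highest pair first, the pairs of `Y` peel off one by one and the closed
-- remainder `pairLab 4` is counted by computation.
∣pairs∣ : ∀ (f : Label → Bool) b → (∀ j s → f (4 ℕ.+ j , s) ≡ b) → ∀ {N k} → N ≡ 4 ℕ.+ k →
          ∣ tabulate (f ∘ pairLab N) ∣ ≡ k ℕ.* (2 ℕ.* weight b) ℕ.+ ∣ tabulate (f ∘ pairLab 4) ∣
∣pairs∣ f b e {k = zero} refl = refl
∣pairs∣ f b e {k = suc k} refl
  with f (4 ℕ.+ k , false) | f (4 ℕ.+ k , true) | e k false | e k true | ∣pairs∣ f b e {k = k} refl
∣pairs∣ f false e {k = suc k} refl | _ | _ | refl | refl | ih = ih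
∣pairs∣ f true  e {k = suc k} refl | _ | _ | refl | refl | ih = cong (2 ℕ.+_) ih

LAdj? : ∀ a b → Dec (LAdj a b)
LAdj? (i , s) (j , t) = ¬? (inX i Bool.≟ inX j) ⊎-dec (¬? (i ℕ.≟ j) ×-dec ¬? (s Bool.≟ t))

LAdj-sym : ∀ {a b} → LAdj a b → LAdj b a
LAdj-sym (inj₁ b≢)        = inj₁ (b≢ ∘ sym)
LAdj-sym (inj₂ (i≢ , s≢)) = inj₂ (i≢ ∘ sym , s≢ ∘ sym)

LAdj-irrefl : ∀ {a} → ¬ LAdj a a
LAdj-irrefl (inj₁ b≢)       = b≢ refl
LAdj-irrefl (inj₂ (i≢ , _)) = i≢ refl

labelledGraph : (Fin m → Label) → Graph m
labelledGraph lab = record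
  { Adj    = λ u v → LAdj (lab u) (lab v)
  ; adj?   = λ u v → LAdj? (lab u) (lab v)
  ; sym    = LAdj-sym
  ; irrefl = λ { refl → LAdj-irrefl }
  }

inBlock : Bool → Label → Bool
inBlock β l = does (inX (proj₁ l) Bool.≟ β)

-- Vertex zero is a twin of the pair vertex (0 , true).
lab : ∀ N → Fin (suc (N ℕ.* 2)) → Label
lab N zero    = 0 , true
lab N (suc v) = pairLab N v

-- The critical graph and its deletions

module Construction (N k : ℕ) (N≡4+k : N ≡ 4 ℕ.+ k) (3≤k : 3 ≤ k) where

  M : ℕ
  M = N ℕ.* 2

  ℓ : Fin (suc M) → Label
  ℓ = lab N

  H : Graph (suc M)
  H = labelledGraph ℓ

  open Indices N≡4+k 3≤k

  lab-< : ∀ v → proj₁ (ℓ v) ℕ.< N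
  lab-< zero    = 0<N
  lab-< (suc v) = pairLab-< N v

  lab-surjective : ∀ i s → i ℕ.< N → ∃[ v ] ℓ v ≡ (i , s)
  lab-surjective i s i< = let v , e = pairLab-surjective N i s i< in suc v , e

  lab-injective : ∀ {u v} → ℓ u ≡ ℓ v → ℓ u ≢ (0 , true) → u ≡ v
  lab-injective {zero}          _ l≢ = contradiction refl l≢
  lab-injective {suc u} {zero}  e l≢ = contradiction e l≢
  lab-injective {suc u} {suc v} e _  = cong suc (pairLab-injective N e)

  -- Only two vertices carry this label, so deleting one of them makes the labelling injective.
  twins : ∀ {u v w} → ℓ u ≡ (0 , true) → ℓ v ≡ (0 , true) → ℓ w ≡ (0 , true) → u ≢ w → v ≢ w → u ≡ v
  twins {zero}  {zero}          _ _ _ _ _ = refl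
  twins {suc u} {suc v}         a b _ _ _ = cong suc (pairLab-injective N (trans a (sym b)))
  twins {zero}  {suc v} {zero}  a b c u≢ v≢ = contradiction refl u≢
  twins {zero}  {suc v} {suc w} a b c u≢ v≢ = contradiction (cong suc (pairLab-injective N (trans b (sym c)))) v≢
  twins {suc u} {zero}  {zero}  a b c u≢ v≢ = contradiction refl v≢
  twins {suc u} {zero}  {suc w} a b c u≢ v≢ = contradiction (cong suc (pairLab-injective N (trans a (sym c)))) u≢

  ∣X∣ : ∣ tabulate (inBlock true ∘ ℓ) ∣ ≡ 9
  ∣X∣ = cong suc (trans (∣pairs∣ (inBlock true) false (λ _ _ → refl) N≡4+k) (cong (ℕ._+ 8) (ℕ.*-zeroʳ k)))

  ∣Y∣ : ∣ tabulate (inBlock false ∘ ℓ) ∣ ≡ k ℕ.* 2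
  ∣Y∣ = trans (∣pairs∣ (inBlock false) true (λ _ _ → refl) N≡4+k) (ℕ.+-identityʳ (k ℕ.* 2))

  -- Alice must be on move with nothing coloured. This fixes `q` as Bob for the odd order of `H`
  -- and, by `even`, as Alice after a deletion.
  odd : turn bob (suc M) ≡ alice
  odd = cong opponent (turn-even bob N)

  even : turn alice M ≡ alice
  even = turn-even alice N

  χ-whole : χᴬᴮ H ≡ 5
  χ-whole = ℕ.≤-antisym upper lower
    where
    open Labelled H bob ℓ (λ a → a) (λ a → a)
    open Whole N≡4+k 3≤k refl odd lab-< lab-surjective lab-injective
      (trans (∣pairs∣ (does ∘ nonzeroInX?) false (λ _ _ → refl) N≡4+k) (cong (ℕ._+ 6) (ℕ.*-zeroʳ k))) ∣Y∣

  module _ (x : Fin (suc M)) where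

    ℓ′ : Fin M → Label
    ℓ′ = ℓ ∘ punchIn x

    open Labelled (H − x) alice ℓ′ (λ a → a) (λ a → a)

    kept : ∀ {l v} → ℓ v ≡ l → v ≢ x → ∃[ u ] ℓ′ u ≡ l
    kept e v≢x = punchOut (v≢x ∘ sym) , trans (cong ℓ (punchIn-punchOut (v≢x ∘ sym))) e

    surjective : ∀ i s → i ℕ.< N → ℓ x ≢ (i , s) → ∃[ u ] ℓ′ u ≡ (i , s)
    surjective i s i< l≢ = let v , e = lab-surjective i s i< in kept e λ { refl → l≢ e }

    injective : ∀ {u v} → ℓ′ u ≡ ℓ′ v → ℓ′ u ≢ (0 , true) → u ≡ v
    injective e l≢ = punchIn-injective x _ _ (lab-injective e l≢)

    missing : ℓ x ≢ (0 , true) → ∀ u → ℓ′ u ≢ ℓ x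
    missing l≢ u e = punchInᵢ≢i x u (sym (lab-injective (sym e) l≢))

    block-size : ∀ β {n} → ∣ tabulate (inBlock β ∘ ℓ) ∣ ≡ n → weight (inBlock β (ℓ x)) ℕ.+ ∣ block β ∣ ≡ n
    block-size β e = trans (sym (∣tabulate-punchIn∣ (inBlock β ∘ ℓ) x)) e

    block-size-≡ : ∀ β {n} → ∣ tabulate (inBlock β ∘ ℓ) ∣ ≡ suc n → inX (proj₁ (ℓ x)) ≡ β → ∣ block β ∣ ≡ n
    block-size-≡ β e b = ℕ.suc-injective (trans
      (cong (λ w → weight w ℕ.+ ∣ block β ∣) (sym (dec-true (inX (proj₁ (ℓ x)) Bool.≟ β) b))) (block-size β e))

    block-size-≢ : ∀ β {n} → ∣ tabulate (inBlock β ∘ ℓ) ∣ ≡ n → inX (proj₁ (ℓ x)) ≢ β → ∣ block β ∣ ≡ n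
    block-size-≢ β e b = trans
      (cong (λ w → weight w ℕ.+ ∣ block β ∣) (sym (dec-false (inX (proj₁ (ℓ x)) Bool.≟ β) b))) (block-size β e)

    open Deleted N≡4+k 3≤k refl even (ℓ x) (lab-< x) (λ v → lab-< (punchIn x v)) surjective injective

    χ-Y : inX (proj₁ (ℓ x)) ≡ false → χᴬᴮ (H − x) ≡ 4
    χ-Y b = ℕ.≤-antisym (in-Y-upper b
      (missing λ e → contradiction (trans (sym b) (cong (inX ∘ proj₁) e)) λ ())
      -- `X` keeps its nine vertices, and this odd number puts Bob on move when only `X` is left.
      (cong (turn alice) (block-size-≢ true ∣X∣ λ t → contradiction (trans (sym b) t) λ ()))) in-Y-lower

    χ-X : inX (proj₁ (ℓ x)) ≡ true → ℓ x ≢ (0 , true) → χᴬᴮ (H − x) ≡ 2 ℕ.+ k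
    χ-X b l≢ = ℕ.≤-antisym (in-X-upper b (missing l≢) size) (in-X-lower b size)
      where
      size : ∣ block false ∣ ≡ k ℕ.* 2
      size = block-size-≢ false ∣Y∣ λ f → contradiction (trans (sym b) f) λ ()

    χ-twin : ℓ x ≡ (0 , true) → χᴬᴮ (H − x) ≡ 4 ℕ.+ k
    χ-twin e = ℕ.≤-antisym
      (perfect-upper (block-size-≡ true ∣X∣ (cong (inX ∘ proj₁) e))
        (block-size-≢ false ∣Y∣ λ f → contradiction (trans (sym (cong (inX ∘ proj₁) e)) f) λ ())) perfect-lower
      where
      all-labels : ∀ i s → i ℕ.< N → ∃[ u ] ℓ′ u ≡ (i , s)
      all-labels i s i< with ℓ x ≟ₗ (i , s)
      ... | no l≢ = surjective i s i< l≢
      -- The label of the deleted vertex survives on the other twin.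
      ... | yes l≡ with x Fin.≟ zero
      ... | no x≢0 = kept (trans (sym e) l≡) (x≢0 ∘ sym)
      ... | yes x≡0 = let v , e′ = pairLab-surjective N i s i< in kept {v = suc v} e′ λ v≡x → contradiction (trans v≡x x≡0) λ ()

      all-distinct : ∀ {u v} → ℓ′ u ≡ ℓ′ v → u ≡ v
      all-distinct {u} {v} e′ with ℓ′ u ≟ₗ (0 , true)
      ... | no l≢ = injective e′ l≢
      ... | yes l≡ = punchIn-injective x u v (twins l≡ (trans (sym e′) l≡) e (punchInᵢ≢i x u) (punchInᵢ≢i x v))

      open Perfect N≡4+k refl even refl (λ v → lab-< (punchIn x v)) all-labels all-distinct

  data Deletion (x : Fin (suc M)) : Set where
    drop  : χᴬᴮ (H − x) ≡ 4 → Deletion x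
    small : χᴬᴮ (H − x) ≡ 2 ℕ.+ k → Deletion x
    large : χᴬᴮ (H − x) ≡ 4 ℕ.+ k → Deletion x

  deletion : ∀ x → Deletion x
  deletion x with inX (proj₁ (ℓ x)) Bool.≟ true | ℓ x ≟ₗ (0 , true)
  ... | no b≢ | _      = drop (χ-Y x (Bool.¬-not b≢))
  ... | yes b | no l≢  = small (χ-X x b l≢)
  ... | yes b | yes l≡ = large (χ-twin x l≡)

  drop-vertex : ∃[ x ] χᴬᴮ (H − x) ≡ 4
  drop-vertex = let x , e = lab-surjective 4 true (two-low ℕ.≤-refl (inj₁ refl)) in x , χ-Y x (cong (inX ∘ proj₁) e)

  small-vertex : ∃[ x ] χᴬᴮ (H − x) ≡ 2 ℕ.+ k
  small-vertex = let x , e = lab-surjective 0 false 0<N in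
    x , χ-X x (cong (inX ∘ proj₁) e) (λ e′ → contradiction (trans (sym (cong proj₂ e)) (cong proj₂ e′)) λ ())

  large-vertex : ∃[ x ] χᴬᴮ (H − x) ≡ 4 ℕ.+ k
  large-vertex = zero , χ-twin zero refl

  critical : 4 ≤ k → MixedGameVertexCritical H
  critical 4≤k = (λ x e → differ x (trans e χ-whole) (deletion x))
    , (let y , e = drop-vertex in y , subst₂ ℕ._<_ (sym e) (sym χ-whole) ℕ.≤-refl)
    , (let y , e = large-vertex in y , subst₂ ℕ._<_ (sym χ-whole) (sym e) (ℕ.+-monoʳ-≤ 4 (ℕ.≤-trans (s≤s (s≤s z≤n)) 4≤k)))
    where
    differ : ∀ x → χᴬᴮ (H − x) ≡ 5 → ¬ Deletion x
    differ x e (drop d)  = contradiction (trans (sym e) d) λ ()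
    -- Here `4 ≤ k` enters: `2 + k` is at least `6`, while `k = 3` would give `5` again.
    differ x e (small d) = ℕ.<⇒≢ (ℕ.+-monoʳ-≤ 2 4≤k) (trans (sym e) d)
    differ x e (large d) = ℕ.<⇒≢ (ℕ.+-monoʳ-≤ 4 (ℕ.≤-trans (s≤s (s≤s z≤n)) 4≤k)) (trans (sym e) d)

-- The set of differences

small-difference : ∀ z → + 5 ℤ.- (+ 2 + z * + 2) ≡ (- (+ 2)) * z + + 3
small-difference = solve-∀

large-difference : ∀ z → + 5 ℤ.- (+ 4 + z * + 2) ≡ (- (+ 2)) * z + + 1
large-difference = solve-∀

differences : ∀ {N} n → N ≡ 4 ℕ.+ n ℕ.* 2 → 2 ≤ n → let G = labelledGraph (lab N) in
  MixedGameVertexCritical G ×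
  Differences G ≐ ｛ + 1 ｝ ∪ ｛ (- (+ 2)) * (+ n) + (+ 3) ｝ ∪ ｛ (- (+ 2)) * (+ n) + (+ 1) ｝
differences {N} n N≡ 2≤n = critical 4≤k , to , from
  where
  4≤k : 4 ≤ n ℕ.* 2
  4≤k = ℕ.*-monoˡ-≤ 2 2≤n
  open Construction N (n ℕ.* 2) N≡ (ℕ.≤-trans (ℕ.n≤1+n 3) 4≤k)
  small-≡ : + 5 ℤ.- + (2 ℕ.+ n ℕ.* 2) ≡ (- (+ 2)) * (+ n) + (+ 3)
  small-≡ = trans (cong (λ z → + 5 ℤ.- (+ 2 + z)) (ℤ.pos-* n 2)) (small-difference (+ n))
  large-≡ : + 5 ℤ.- + (4 ℕ.+ n ℕ.* 2) ≡ (- (+ 2)) * (+ n) + (+ 1)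
  large-≡ = trans (cong (λ z → + 5 ℤ.- (+ 4 + z)) (ℤ.pos-* n 2)) (large-difference (+ n))
  difference : ∀ {x a} → χᴬᴮ (H − x) ≡ a → (+ χᴬᴮ H) ℤ.- (+ χᴬᴮ (H − x)) ≡ + 5 ℤ.- + a
  difference e = cong₂ (λ a b → + a ℤ.- + b) χ-whole e
  to : ∀ {d} → Differences H d → (｛ + 1 ｝ ∪ ｛ (- (+ 2)) * (+ n) + (+ 3) ｝ ∪ ｛ (- (+ 2)) * (+ n) + (+ 1) ｝) d
  to (x , refl) with deletion x
  ... | drop e  = inj₁ (sym (difference {x} e))
  ... | small e = inj₂ (inj₁ (sym (trans (difference {x} e) small-≡)))
  ... | large e = inj₂ (inj₂ (sym (trans (difference {x} e) large-≡)))
  from : ∀ {d} → (｛ + 1 ｝ ∪ ｛ (- (+ 2)) * (+ n) + (+ 3) ｝ ∪ ｛ (- (+ 2)) * (+ n) + (+ 1) ｝) d → Differences H d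
  from (inj₁ refl)        = let x , e = drop-vertex in x , sym (difference {x} e)
  from (inj₂ (inj₁ refl)) = let x , e = small-vertex in x , sym (trans (difference {x} e) small-≡)
  from (inj₂ (inj₂ refl)) = let x , e = large-vertex in x , sym (trans (difference {x} e) large-≡)

proposition20 : ∀ (n : ℕ) → n ≥ 2 →
    ∃[ m ] Σ[ G ∈ Graph m ]
    MixedGameVertexCritical G ×
    Differences G ≐ ｛ + 1 ｝ ∪ ｛ (- (+ 2)) * (+ n) + (+ 3) ｝ ∪ ｛ (- (+ 2)) * (+ n) + (+ 1) ｝
proposition20 n n≥2 = _ , labelledGraph (lab (4 ℕ.+ n ℕ.* 2)) , differences n refl n≥2
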